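{- Let $\eta\in(0,1)$ be fixed, and let $P$ be sufficiently large in terms of $\eta$. Suppose that $\mathbf h=(h_1,h_2,h_4)\in\mathbb Z^3$ is a coefficient triple with the property that $T_2(P;\mathbf h)>P^\eta$. Then the tuple $\mathbf h$ satisfies one of the following two conditions: (a) for some integers $a$ and $b$ with $a\ne b$ and $1\le a,b\le P$, one has $h_j=a^j-b^j$ $(j=1,2,4)$, in which case $T_2(P;\mathbf h)=4P$; (b) one has $h_j=0$ $(j=1,2,4)$, in which case $T_2(P;\mathbf 0)=2P^2-P$. In particular, if $\mathbf h$ satisfies neither condition (a) nor condition (b), then $T_2(P;\mathbf h)=O(P^\varepsilon)$.
   Context: $P$ denotes a large positive integer. For an integer triple $\mathbf h=(h_1,h_2,h_4)\in\mathbb Z^3$ (indexed by $1,2,4$), $T_2(P;\mathbf h)$ denotes the number of integral solutions $(x_1,x_2,y_1,y_2)$ of the system $$x_1^j+x_2^j-y_1^j-y_2^j=h_j\quad (j=1,2,4),$$ with $1\le x_i,y_i\le P$ $(i=1,2)$. A statement involving $\varepsilon$ is asserted to hold for each $\varepsilon>0$.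
   Formalization: In (a) the printed value T_2(P;h)=4P is false and is corrected to 4P-4: the choices t=a and t=b each give only two ordered solutions instead of four. -}

module Defs where

open import Data.Integer as ℤ using (ℤ; +_)
open import Data.List using (List; map; upTo; cartesianProduct; filter; length)
open import Data.Nat as ℕ using (ℕ; suc; NonZero)
open import Data.Product using (_×_; _,_; ∃; ∃-syntax; Σ-syntax)
open import Data.Rational as ℚ using (ℚ; 0ℚ; 1ℚ)
open import Data.Sum using (_⊎_)
open import Function.Bundles using (_⇔_)
open import Relation.Binary.PropositionalEquality using (_≡_; _≢_)
open import Relation.Nullary using (¬_; Dec)
open import Relation.Nullary.Decidable using (_×-dec_)

-- Real numbers as two-sided Dedekind cuts: L q means q < x, U q means x < q.
record ℝ : Set₁ where
  field
    L U       : ℚ → Set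
    inhabited : ∃ L × ∃ U
    L-rounded : ∀ q → L q ⇔ (∃[ r ] (q ℚ.< r × L r))
    U-rounded : ∀ q → U q ⇔ (∃[ r ] (r ℚ.< q × U r))
    disjoint  : ∀ q → ¬ (L q × U q)
    located   : ∀ {q r} → q ℚ.< r → L q ⊎ U r

0<_ : ℝ → Set
0< x = ℝ.L x 0ℚ

_<1 : ℝ → Set
x <1 = ℝ.U x 1ℚ

infix 4 0<_ _<1

-- P ^ x < T for a real x > 0 and P ≥ 1.  Since r ↦ P ^ r is continuous and
-- nondecreasing, this holds iff P ^ (p / q) < T for some rational p / q > x,
-- and P ^ (p / q) < T means P ^ p < T ^ q.  Only natural numerators are needed
-- because x > 0.
PowerBelow : ℕ → ℝ → ℕ → Set
PowerBelow P x T =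
  Σ[ p ∈ ℕ ] Σ[ q ∈ ℕ ] Σ[ q≢0 ∈ NonZero q ]
    (ℝ.U x (ℚ._/_ (+ p) q {{q≢0}}) × P ℕ.^ p ℕ.< T ℕ.^ q)

-- T ≤ C · P ^ x for a real x > 0 and P ≥ 1: by continuity, this holds iff
-- T ≤ C · P ^ (p / q), that is T ^ q ≤ C ^ q · P ^ p, for all rationals p / q > x.
BoundedByPower : ℕ → ℕ → ℕ → ℝ → Set
BoundedByPower T C P x =
  ∀ p q {{_ : NonZero q}} → ℝ.U x (+ p ℚ./ q) →
  T ℕ.^ q ℕ.≤ C ℕ.^ q ℕ.* P ℕ.^ p

record Triple : Set where
  constructor triple
  field
    h₁ h₂ h₄ : ℤ

-- f j = h_j for j = 1, 2, 4
Matches : (ℕ → ℤ) → Triple → Set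
Matches f h = (f 1 ≡ Triple.h₁ h) × (f 2 ≡ Triple.h₂ h) × (f 4 ≡ Triple.h₄ h)

matches? : ∀ f h → Dec (Matches f h)
matches? f h =
  (f 1 ℤ.≟ Triple.h₁ h) ×-dec (f 2 ℤ.≟ Triple.h₂ h) ×-dec (f 4 ℤ.≟ Triple.h₄ h)

Quad : Set
Quad = ℤ × ℤ × ℤ × ℤ

powerSum : Quad → ℕ → ℤ
powerSum (x₁ , x₂ , y₁ , y₂) j =
  x₁ ℤ.^ j ℤ.+ x₂ ℤ.^ j ℤ.- y₁ ℤ.^ j ℤ.- y₂ ℤ.^ j

IsSolution : Triple → Quad → Set
IsSolution h z = Matches (powerSum z) h

isSolution? : ∀ h z → Dec (IsSolution h z)
isSolution? h z = matches? (powerSum z) h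

-- the integers 1, …, P
range : ℕ → List ℤ
range P = map (λ i → + suc i) (upTo P)

box : ℕ → List Quad
box P = cartesianProduct I (cartesianProduct I (cartesianProduct I I))
  where I = range P

T₂ : ℕ → Triple → ℕ
T₂ P h = length (filter (isSolution? h) (box P))

ConditionA : ℕ → Triple → Set
ConditionA P h =
  ∃[ a ] ∃[ b ]
    ( a ≢ b
    × (+ 1 ℤ.≤ a) × (a ℤ.≤ + P)
    × (+ 1 ℤ.≤ b) × (b ℤ.≤ + P)
    × Matches (λ j → a ℤ.^ j ℤ.- b ℤ.^ j) h )

ConditionB : Triple → Set
ConditionB h = Matches (λ _ → + 0) h

-- The value of T₂ P h under ConditionA P h.  The solutions are those with
-- {x₁ , x₂} = {a , t} and {y₁ , y₂} = {b , t} as multisets, 1 ≤ t ≤ P.  There are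
-- 4 for each t other than a and b, but only 2 for t = a and only 2 for t = b, so
-- the exact value is 4 (P - 2) + 2 + 2 = 4 P - 4.  In the
-- source the value is printed as 4 P, overlooking these two coincidences.  Since
-- P ≥ 2 here, ∸ does not truncate.
countA : ℕ → ℕ
countA P = 4 ℕ.* P ℕ.∸ 4

countB : ℕ → ℕ
countB P = 2 ℕ.* P ℕ.^ 2 ℕ.∸ P

{-# OPTIONS --safe #-}
module Submission where

-- Put A = h₁² + h₂, W = h₂ + h₁ (x₁ + x₂ + y₁ + y₂) and M = h₂³ + h₁⁴ h₂ - 2 h₁² h₄.
-- Every solution satisfies M = W (2 h₁ x₁ - A) (2 h₁ x₂ - A), and likewise for y₁, y₂
-- with h₂ - h₁² in place of A.
--   * If h₁ ≠ 0 and M ≠ 0, the linear factors are divisors of M and determine the solution.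
--   * If h₁ ≠ 0 and M = 0, a solution with W ≠ 0 has some xᵢ = a and some yⱼ = b with
--     h = (a - b , a² - b² , a⁴ - b⁴).  If all solutions have W = 0, then
--     (y₁ - y₂)² - (x₁ - x₂)² = -3 h₂ ≠ 0, whose factors determine the solution.
--   * If h₁ = 0 and h₂ ≠ 0, then 2 (x₁ - y₁) (x₁ - y₂) = h₂, and the two factors
--     determine the solution because x₁ and x₂ are positive.
--   * If h₁ = h₂ = 0, then h₄ = 0.
-- Apart from the cases (a) and (b), the divisor bound therefore gives T₂ ≪ P^ε.

open import Defs
open import Algebra.Bundles using (AbelianGroup)
import Algebra.Properties.Group as GroupProperties
open import Data.Integer as ℤ using (ℤ; +_; -[1+_]; ∣_∣; 0ℤ; +≤+)
import Data.Integer.Properties as ℤₚ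
import Data.Integer.Tactic.RingSolver as ℤ-Solver
open import Data.List using (List; []; _∷_; map; length; _++_; filter; cartesianProduct; upTo; concat)
open import Data.List.Membership.Propositional using (_∈_; find; lose)
open import Data.List.Membership.Propositional.Properties
open import Data.List.Properties using (length-++; length-map; length-upTo)
open import Data.List.Relation.Binary.Disjoint.Propositional using (Disjoint)
open import Data.List.Relation.Binary.Subset.Propositional using (_⊆_)
open import Data.List.Relation.Unary.All as All using (All; []; _∷_)
open import Data.List.Relation.Unary.AllPairs using ([]; _∷_)
open import Data.List.Relation.Unary.Any as Any using (here; there)
open import Data.List.Relation.Unary.Unique.Propositional using (Unique)
import Data.List.Relation.Unary.Unique.Propositional.Properties as Uniqueₚ
open import Data.Nat as ℕ using (ℕ; _≤_; zero; suc; NonZero; z≤n; s≤s)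
import Data.Nat.Divisibility as ℕᵈ
import Data.Nat.Properties as ℕₚ
import Data.Nat.Tactic.RingSolver as ℕ-Solver
open import Data.Product using (_×_; _,_; ∃-syntax; proj₁; proj₂)
open import Data.Rational as ℚ using (mkℚ; 0ℚ)
import Data.Rational.Properties as ℚₚ
import Data.Rational.Unnormalised as ℚᵘ
import Data.Rational.Unnormalised.Properties as ℚᵘₚ
open import Data.Sum using (_⊎_; inj₁; inj₂; [_,_]′; map₁) renaming (map to map⊎)
open import Function using (_∘_)
open import Function.Bundles using (Equivalence)
open import Level using (Level)
open import Relation.Binary.Definitions using (tri<; tri≈; tri>)
open import Relation.Binary.PropositionalEquality
  using (_≡_; _≢_; refl; sym; trans; cong; cong₂; subst; module ≡-Reasoning)
open import Relation.Nullary using (Dec; ¬_; yes; no; contradiction; ¬?)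
open import Relation.Nullary.Decidable using (decidable-stable)
open import Relation.Unary using (Pred; Decidable)

-- All exponents are integers. The divisor function is bounded in the form d(n)^k ≤ C n, and a real
-- η > 0 enters only through an integer K with p / q ≥ 1 / K for every rational p / q > η. Outside
-- (a) and (b) it then suffices to have T^K ≤ C P: roots turn this into T = O(P^η), and the same
-- bound with 2 K in place of K contradicts T > P^η once P > C. The obstacle is that M = 0 alone
-- does not produce (a). For h₁ ≠ 0 let a and b be the rationals with a - b = h₁ and a² - b² = h₂.
-- The triples x₁, x₂, b and y₁, y₂, a have the same sum and the same sum of squares, and W is 2 h₁
-- times their common sum. If that sum is 0, their sums of fourth powers agree automatically, so the
-- quartic equation no longer singles out a coordinate. Such solutions have to be counted from the
-- linear and quadratic equations alone, and the positivity of the variables is what makes 3 h₂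
-- nonzero there.

module _ where
  open import Data.Nat
  open import Data.Nat.Coprimality using (Coprime; coprime-divisor)
  open import Data.Nat.DivMod using (m≡m%n+[m/n]*n; m%n<n)
  open import Data.Nat.Divisibility
  open import Data.Nat.Induction using (<-rec)
  open import Data.Nat.ListAction using (product)
  open import Data.Nat.Primality
  open import Data.Nat.Primality.Factorisation using (PrimeFactorisation; factorise)
  open import Data.Nat.Properties
  open import Data.Nat.Tactic.RingSolver using (solve-∀)

  -- Elementary bounds on powers

  ^-distribʳ-* : ∀ k m n → (m * n) ^ k ≡ m ^ k * n ^ k
  ^-distribʳ-* zero    m n = refl
  ^-distribʳ-* (suc k) m n =
    trans (cong (m * n *_) (^-distribʳ-* k m n)) (interchange m n (m ^ k) (n ^ k))
    where
    interchange : ∀ a b c d → a * b * (c * d) ≡ a * c * (b * d)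
    interchange = solve-∀

  1+n≤2^n : ∀ n → suc n ≤ 2 ^ n
  1+n≤2^n zero    = ≤-refl
  1+n≤2^n (suc n) = begin
    1 + suc n         ≤⟨ +-mono-≤ (m^n>0 2 n) (1+n≤2^n n) ⟩
    2 ^ n + 2 ^ n     ≡⟨ cong (λ m → 2 ^ n + m) (sym (+-identityʳ (2 ^ n))) ⟩
    2 ^ suc n         ∎
    where open ≤-Reasoning

  -- With q the integer part of n / k, 1 + n ≤ k (q + 1) ≤ k 2^q; raise this to the power k. It lets
  -- the factor a + 1 that a prime power p^a contributes to the divisor count be paid for by p^a, at
  -- the cost of a constant k^k.
  [1+n]^k≤k^k*2^n : ∀ k .{{_ : NonZero k}} n → suc n ^ k ≤ k ^ k * 2 ^ n
  [1+n]^k≤k^k*2^n k n = begin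
    suc n ^ k            ≤⟨ ^-monoˡ-≤ k 1+n≤k*2^q ⟩
    (k * 2 ^ q) ^ k      ≡⟨ ^-distribʳ-* k k (2 ^ q) ⟩
    k ^ k * (2 ^ q) ^ k  ≡⟨ cong (k ^ k *_) (^-*-assoc 2 q k) ⟩
    k ^ k * 2 ^ (q * k)  ≤⟨ *-monoʳ-≤ (k ^ k) (^-monoʳ-≤ 2 q*k≤n) ⟩
    k ^ k * 2 ^ n        ∎
    where
    open ≤-Reasoning
    q = n / k
    q*k≤n : q * k ≤ n
    q*k≤n = subst (q * k ≤_) (sym (m≡m%n+[m/n]*n n k)) (m≤n+m (q * k) (n % k))
    1+n≤k*2^q : suc n ≤ k * 2 ^ q
    1+n≤k*2^q = begin
      suc n                ≡⟨ cong suc (m≡m%n+[m/n]*n n k) ⟩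
      suc (n % k) + q * k  ≤⟨ +-monoˡ-≤ (q * k) (m%n<n n k) ⟩
      suc q * k            ≤⟨ *-monoˡ-≤ k (1+n≤2^n q) ⟩
      2 ^ q * k            ≡⟨ *-comm (2 ^ q) k ⟩
      k * 2 ^ q            ∎

  -- The divisor bound

  DivisorsIn : ℕ → List ℕ → Set
  DivisorsIn n L = ∀ {d} → d ∣ n → d ∈ L

  -- The bound d(n) ≪ n^(1/k) with the root cleared.
  FewDivisors : ℕ → ℕ → ℕ → Set
  FewDivisors k C n = ∃[ L ] (DivisorsIn n L × length L ^ k ≤ C * n)

  module _ {p : ℕ} (pp : Prime p) where

    private instance
      p≢0 : NonZero p
      p≢0 = prime⇒nonZero pp

    ∤⇒coprime : ∀ {d} → p ∤ d → Coprime d p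
    ∤⇒coprime p∤d (e∣d , e∣p) with prime⇒irreducible pp e∣p
    ... | inj₁ e≡1  = e≡1
    ... | inj₂ refl = contradiction e∣d p∤d

    ∤-∣p^a*m : ∀ a {d m} → p ∤ d → d ∣ p ^ a * m → d ∣ m
    ∤-∣p^a*m zero    {m = m} p∤d d∣ = subst (_ ∣_) (+-identityʳ m) d∣
    ∤-∣p^a*m (suc a) {d} {m} p∤d d∣ =
      ∤-∣p^a*m a p∤d (coprime-divisor (∤⇒coprime p∤d) (subst (d ∣_) (*-assoc p (p ^ a) m) d∣))

    -- A divisor of p ^ a * m either divides m or is p times a divisor of p ^ (a - 1) * m.
    divisors-p^a*m : ∀ a {m L} → DivisorsIn m L →
      ∃[ L′ ] (DivisorsIn (p ^ a * m) L′ × length L′ ≡ suc a * length L)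
    divisors-p^a*m zero    {m} {L} div =
      L , (λ d∣ → div (subst (_ ∣_) (+-identityʳ m) d∣)) , sym (+-identityʳ (length L))
    divisors-p^a*m (suc a) {m} {L} div with divisors-p^a*m a div
    ... | L′ , div′ , len =
      L ++ map (p *_) L′ , split ,
      trans (length-++ L) (cong (λ m → length L + m) (trans (length-map (p *_) L′) len))
      where
      split : DivisorsIn (p ^ suc a * m) (L ++ map (p *_) L′)
      split {d} d∣ with p ∣? d
      ... | no p∤d = ∈-++⁺ˡ (div (∤-∣p^a*m (suc a) p∤d d∣))
      ... | yes (divides e refl) =
        ∈-++⁺ʳ L (subst (_∈ map (p *_) L′) (*-comm p e) (∈-map⁺ (p *_) (div′
          (*-cancelˡ-∣ p (subst (_∣ p * (p ^ a * m)) (*-comm e p) (subst (e * p ∣_) (*-assoc p (p ^ a) m) d∣))))))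

    ∃-p-part : ∀ n → .{{NonZero n}} → ∃[ a ] ∃[ m ] (n ≡ p ^ a * m × p ∤ m)
    ∃-p-part = <-rec (λ n → .{{NonZero n}} → ∃[ a ] ∃[ m ] (n ≡ p ^ a * m × p ∤ m)) go
      where
      go : ∀ n → (∀ {n′} → n′ < n → .{{NonZero n′}} → ∃[ a ] ∃[ m ] (n′ ≡ p ^ a * m × p ∤ m)) →
           .{{NonZero n}} → ∃[ a ] ∃[ m ] (n ≡ p ^ a * m × p ∤ m)
      go n rec with p ∣? n
      ... | no p∤n  = 0 , n , sym (+-identityʳ n) , p∤n
      ... | yes p∣n with rec (quotient-< p∣n {{prime⇒nonTrivial pp}}) {{quotient≢0 p∣n}}
      ...   | a , m , eq , p∤m =
        suc a , m , trans (m∣n⇒n≡m*quotient p∣n) (trans (cong (p *_) eq) (sym (*-assoc p (p ^ a) m))) , p∤m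

  -- A prime p ≥ 2 ^ k at most doubles the number of divisors, and 2 ^ k ≤ p.
  rough-fewDivisors : ∀ k n → .{{NonZero n}} → (2 ^ k) Rough n → FewDivisors k 1 n
  rough-fewDivisors k n rough =
    subst (FewDivisors k 1) (sym isFactorisation)
      (go factors factorsPrime (subst ((2 ^ k) Rough_) isFactorisation rough))
    where
    open PrimeFactorisation (factorise n)
    go : ∀ ps → All Prime ps → (2 ^ k) Rough (product ps) → FewDivisors k 1 (product ps)
    go [] [] _ = 1 ∷ [] , (λ d∣1 → here (∣1⇒≡1 d∣1)) , ≤-reflexive (^-zeroˡ k)
    go (p ∷ ps) (pp ∷ pps) r
      with go ps pps (rough∧∣⇒rough r (n∣m*n p))
    -- A prime that occurs several times doubles the list once per occurrence; each occurrence
    -- brings its own factor p ≥ 2^k to the product, so the bound still closes.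
    ... | L , div , len with divisors-p^a*m pp 1 div
    ... | L′ , div′ , len′ = L′ , (λ d∣ → div′ (subst (λ q → _ ∣ q * product ps) (sym (*-identityʳ p)) d∣)) , bound
      where
      open ≤-Reasoning
      2^k≤p : 2 ^ k ≤ p
      2^k≤p = ≮⇒≥ (λ p<2^k → r (hasNonTrivialDivisor {{prime⇒nonTrivial pp}} p<2^k (m∣m*n (product ps))))
      bound : length L′ ^ k ≤ 1 * (p * product ps)
      bound = begin
        length L′ ^ k             ≡⟨ cong (_^ k) len′ ⟩
        (2 * length L) ^ k        ≡⟨ ^-distribʳ-* k 2 (length L) ⟩
        2 ^ k * length L ^ k      ≤⟨ *-mono-≤ 2^k≤p len ⟩
        p * (1 * product ps)      ≡⟨ cong (p *_) (*-identityˡ _) ⟩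
        p * product ps            ≡⟨ sym (*-identityˡ _) ⟩
        1 * (p * product ps)      ∎

  -- A divisor j of a j-rough number is prime. Removing its full power j^a leaves a number that is
  -- rough for j + 1, and the lost factor (a + 1)^k is at most k^k 2^a ≤ k^k j^a. If j does not
  -- divide n, only the constant is weakened.
  fewDivisors-pred : ∀ k .{{_ : NonZero k}} j C → 2 ≤ j →
    (∀ n → .{{NonZero n}} → suc j Rough n → FewDivisors k C n) →
    ∀ n → .{{NonZero n}} → j Rough n → FewDivisors k (k ^ k * C) n
  fewDivisors-pred k j C 2≤j few n rough with j ∣? n
  ... | no j∤n with few n (∤⇒rough-suc j∤n rough)
  ...   | L , div , len =
    L , div , ≤-trans len (*-monoˡ-≤ n (m≤n*m C (k ^ k) {{m^n≢0 k k}}))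
  fewDivisors-pred k j C 2≤j few n rough | yes j∣n
    with rough∧∣⇒prime {{n>1⇒nonTrivial 2≤j}} rough j∣n
  ... | pj with ∃-p-part pj n
  ... | a , m , refl , j∤m
    with few m {{m*n≢0⇒n≢0 (j ^ a)}} (∤⇒rough-suc j∤m (rough∧∣⇒rough rough (n∣m*n (j ^ a))))
  ... | L , div , len with divisors-p^a*m pj a div
  ... | L′ , div′ , len′ = L′ , div′ , bound
    where
    open ≤-Reasoning
    rearrange : ∀ x y z w → x * y * (z * w) ≡ x * z * (y * w)
    rearrange = solve-∀
    bound : length L′ ^ k ≤ k ^ k * C * (j ^ a * m)
    bound = begin
      length L′ ^ k                   ≡⟨ cong (_^ k) len′ ⟩
      (suc a * length L) ^ k          ≡⟨ ^-distribʳ-* k (suc a) (length L) ⟩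
      suc a ^ k * length L ^ k        ≤⟨ *-mono-≤ ([1+n]^k≤k^k*2^n k a) len ⟩
      k ^ k * 2 ^ a * (C * m)         ≤⟨ *-monoˡ-≤ (C * m) (*-monoʳ-≤ (k ^ k) (^-monoˡ-≤ a 2≤j)) ⟩
      k ^ k * j ^ a * (C * m)         ≡⟨ rearrange (k ^ k) (j ^ a) C m ⟩
      k ^ k * C * (j ^ a * m)         ∎

  -- Only primes below 2 ^ k cost a constant; they are removed one at a time.
  divisorBound : ∀ k .{{_ : NonZero k}} → ∃[ C ] (∀ n → .{{NonZero n}} → FewDivisors k C n)
  divisorBound k with descend (2 ^ k ∸ 2) 2 ≤-refl (m+[n∸m]≡n 2≤2^k)
    where
    2≤2^k : 2 ≤ 2 ^ k
    2≤2^k = ^-monoʳ-≤ 2 (>-nonZero⁻¹ k)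
    descend : ∀ i j → 2 ≤ j → j + i ≡ 2 ^ k →
              ∃[ C ] (∀ n → .{{NonZero n}} → j Rough n → FewDivisors k C n)
    descend zero    j 2≤j eq =
      1 , λ n rough → rough-fewDivisors k n (subst (_Rough n) (trans (sym (+-identityʳ j)) eq) rough)
    descend (suc i) j 2≤j eq
      with descend i (suc j) (m≤n⇒m≤1+n 2≤j) (trans (sym (+-suc j i)) eq)
    ... | C , few = k ^ k * C , fewDivisors-pred k j C 2≤j few
  ... | C , few = C , λ n → few n 2-rough

  -- Cardinalities of lists

  private variable
    a b p : Level
    A : Set a
    B : Set b

  length-⊆ : {xs ys : List A} → Unique xs → xs ⊆ ys → length xs ≤ length ys
  length-⊆ {xs = []}     _ _ = z≤n
  length-⊆ {xs = x ∷ xs} (x∉xs ∷ xs!) xs⊆ys with ∈-∃++ (xs⊆ys (here refl))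
  ... | as , bs , refl = begin
    suc (length xs)                ≤⟨ s≤s (length-⊆ xs! without-x) ⟩
    suc (length (as ++ bs))        ≡⟨ cong suc (length-++ as) ⟩
    suc (length as + length bs)    ≡⟨ sym (+-suc (length as) (length bs)) ⟩
    length as + suc (length bs)    ≡⟨ sym (length-++ as) ⟩
    length (as ++ x ∷ bs)          ∎
    where
    open ≤-Reasoning
    without-x : xs ⊆ as ++ bs
    without-x y∈xs with ∈-++⁻ as (xs⊆ys (there y∈xs))
    ... | inj₁ y∈as           = ∈-++⁺ˡ y∈as
    ... | inj₂ (here refl)    = contradiction refl (All.lookup x∉xs y∈xs)
    ... | inj₂ (there y∈bs)   = ∈-++⁺ʳ as y∈bs

  length-≡ : {xs ys : List A} → Unique xs → Unique ys → xs ⊆ ys → ys ⊆ xs → length xs ≡ length ys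
  length-≡ xs! ys! xs⊆ys ys⊆xs = ≤-antisym (length-⊆ xs! xs⊆ys) (length-⊆ ys! ys⊆xs)

  Unique-map⁺ : {f : A → B} {xs : List A} → Unique xs →
    (∀ {x y} → x ∈ xs → y ∈ xs → f x ≡ f y → x ≡ y) → Unique (map f xs)
  Unique-map⁺ {xs = []} _ _ = []
  Unique-map⁺ {f = f} {x ∷ xs} (x∉xs ∷ xs!) inj =
    All.tabulate fx∉ ∷ Unique-map⁺ xs! (λ u v → inj (there u) (there v))
    where
    fx∉ : ∀ {y} → y ∈ map f xs → f x ≢ y
    fx∉ y∈ fx≡y with ∈-map⁻ f y∈
    ... | z , z∈xs , refl = All.lookup x∉xs z∈xs (inj (here refl) (there z∈xs) fx≡y)

  -- Injectivity is asked on the entries of `xs` only: some of the codes used later determine a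
  -- point only among the solutions.
  length-injection : {f : A → B} {xs : List A} {ys : List B} → Unique xs →
    (∀ {x y} → x ∈ xs → y ∈ xs → f x ≡ f y → x ≡ y) →
    (∀ {x} → x ∈ xs → f x ∈ ys) → length xs ≤ length ys
  length-injection {f = f} {xs} {ys} xs! inj into = begin
    length xs          ≡⟨ sym (length-map f xs) ⟩
    length (map f xs)  ≤⟨ length-⊆ (Unique-map⁺ xs! inj) image ⟩
    length ys          ∎
    where
    open ≤-Reasoning
    image : map f xs ⊆ ys
    image y∈ with ∈-map⁻ f y∈
    ... | x , x∈xs , refl = into x∈xs

  length-cartesianProduct : (xs : List A) (ys : List B) →
    length (cartesianProduct xs ys) ≡ length xs * length ys
  length-cartesianProduct []       ys = refl
  length-cartesianProduct (x ∷ xs) ys =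
    trans (length-++ (map (x ,_) ys)) (cong₂ _+_ (length-map (x ,_) ys) (length-cartesianProduct xs ys))

  module _ {A : Set a} {P : Pred A p} (P? : Decidable P) where

    length-filter-¬ : ∀ xs → length (filter P? xs) + length (filter (¬? ∘ P?) xs) ≡ length xs
    length-filter-¬ [] = refl
    length-filter-¬ (x ∷ xs) with P? x
    ... | yes _ = cong suc (length-filter-¬ xs)
    ... | no  _ = trans (+-suc _ _) (cong suc (length-filter-¬ xs))

  -- Real exponents

  L<U : ∀ (x : ℝ) {r s} → ℝ.L x r → ℝ.U x s → r ℚ.< s
  L<U x {r} {s} Lr Us with ℚₚ.<-cmp r s
  ... | tri< r<s _ _  = r<s
  ... | tri≈ _ refl _ = contradiction (Lr , Us) (ℝ.disjoint x r)
  ... | tri> _ _ s<r  =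
    contradiction (Equivalence.from (ℝ.L-rounded x s) (r , s<r , Lr) , Us) (ℝ.disjoint x s)

  -- Roundedness of the lower cut gives a rational n / d with 0 < n / d < x. Any p / q > x then
  -- exceeds n / d ≥ 1 / d, so K = d works.
  archimedean : ∀ (x : ℝ) → 0< x →
    ∃[ K ] (NonZero K × (∀ p q {{_ : NonZero q}} → ℝ.U x (+ p ℚ./ q) → q ≤ p * K))
  archimedean x 0<x with Equivalence.to (ℝ.L-rounded x 0ℚ) 0<x
  ... | r@(mkℚ (+ n) d-1 _) , 0<r , Lr = suc d-1 , _ , below
    where
    n≢0 : ∀ n → 0ℚ ℚ.< r → + n ≡ ℚ.↥ r → NonZero n
    n≢0 zero    0<r refl = contradiction (subst (+ 0 ℤ.<_) (ℤₚ.*-identityʳ (+ 0)) (ℚₚ.drop-*<* 0<r)) (ℤₚ.<-irrefl refl)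
    n≢0 (suc n) _ _ = _
    below : ∀ p q {{_ : NonZero q}} → ℝ.U x (+ p ℚ./ q) → q ≤ p * suc d-1
    below p q@(suc q-1) Us = begin
      q              ≤⟨ m≤n*m q n {{n≢0 n 0<r refl}} ⟩
      n * q          ≤⟨ <⇒≤ (ℤₚ.drop‿+<+ cross) ⟩
      p * suc d-1    ∎
      where
      open ≤-Reasoning
      cross : + (n * q) ℤ.< + (p * suc d-1)
      cross = to-products (ℚᵘₚ.drop-*<* (ℚᵘₚ.<-respʳ-≃ (ℚₚ.toℚᵘ-fromℚᵘ (ℚᵘ.mkℚᵘ (+ p) q-1)) (ℚₚ.toℚᵘ-mono-< (L<U x Lr Us))))
        where
        to-products : + n ℤ.* + q ℤ.< + p ℤ.* + suc d-1 → + (n * q) ℤ.< + (p * suc d-1)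
        to-products rewrite ℤₚ.pos-* n q | ℤₚ.pos-* p (suc d-1) = λ lt → lt
  ... | mkℚ -[1+ n ] d-1 _ , ℚ.*<* () , Lr

  ^-cancelˡ-≤ : ∀ k .{{_ : NonZero k}} {m n} → m ^ k ≤ n ^ k → m ≤ n
  ^-cancelˡ-≤ k m^k≤n^k = ≮⇒≥ (λ n<m → <⇒≱ (^-monoˡ-< k n<m) m^k≤n^k)

  ^-cancelˡ-< : ∀ k {m n} → m ^ k < n ^ k → m < n
  ^-cancelˡ-< k m^k<n^k = ≰⇒> (λ n≤m → <⇒≱ m^k<n^k (^-monoˡ-≤ k n≤m))

  m≤m^k : ∀ k .{{_ : NonZero k}} m → m ≤ m ^ k
  m≤m^k k         zero    = z≤n
  m≤m^k k@(suc _) (suc m) =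
    subst (_≤ suc m ^ k) (^-identityʳ (suc m)) (^-monoʳ-≤ (suc m) {1} {k} (s≤s z≤n))

  ^-swap : ∀ m i j → (m ^ i) ^ j ≡ (m ^ j) ^ i
  ^-swap m i j =
    trans (^-*-assoc m i j) (trans (cong (m ^_) (*-comm i j)) (sym (^-*-assoc m j i)))

  module _ {P p q K : ℕ} .{{_ : NonZero P}} .{{_ : NonZero K}} (q≤p*K : q ≤ p * K) where
    open ≤-Reasoning

    private
      P^q≤[P^p]^K : P ^ q ≤ (P ^ p) ^ K
      P^q≤[P^p]^K = ≤-trans (^-monoʳ-≤ P q≤p*K) (≤-reflexive (sym (^-*-assoc P p K)))

    -- Raise the hypothesis to the power q, use P^q ≤ P^(p K), and extract a K-th root. Enlarging
    -- C^q to its K-th power makes the right side a perfect K-th power.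
    root-≤ : ∀ {T C} → T ^ K ≤ C * P → T ^ q ≤ C ^ q * P ^ p
    root-≤ {T} {C} T^K≤C*P = ^-cancelˡ-≤ K (begin
      (T ^ q) ^ K              ≡⟨ ^-swap T q K ⟩
      (T ^ K) ^ q              ≤⟨ ^-monoˡ-≤ q T^K≤C*P ⟩
      (C * P) ^ q              ≡⟨ ^-distribʳ-* q C P ⟩
      C ^ q * P ^ q            ≤⟨ *-mono-≤ (m≤m^k K (C ^ q)) P^q≤[P^p]^K ⟩
      (C ^ q) ^ K * (P ^ p) ^ K ≡⟨ sym (^-distribʳ-* K (C ^ q) (P ^ p)) ⟩
      (C ^ q * P ^ p) ^ K      ∎)

    -- From P^q ≤ P^(p K) < T^(q K) one gets P < T^K, hence P² ≤ T^(2 K) ≤ C P. The doubled exponent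
    -- supplies the spare factor P.
    power-gap : ∀ {T C} → P ^ p < T ^ q → T ^ (K * 2) ≤ C * P → P ≤ C
    power-gap {T} {C} P^p<T^q T^2K≤C*P = *-cancelʳ-≤ P C P (begin
      P * P              ≡⟨ cong (P *_) (sym (*-identityʳ P)) ⟩
      P ^ 2              ≤⟨ ^-monoˡ-≤ 2 (<⇒≤ P<T^K) ⟩
      (T ^ K) ^ 2        ≡⟨ ^-*-assoc T K 2 ⟩
      T ^ (K * 2)        ≤⟨ T^2K≤C*P ⟩
      C * P              ∎)
      where
      P<T^K : P < T ^ K
      P<T^K = ^-cancelˡ-< q (begin-strict
        P ^ q          ≤⟨ P^q≤[P^p]^K ⟩
        (P ^ p) ^ K    <⟨ ^-monoˡ-< K P^p<T^q ⟩
        (T ^ q) ^ K    ≡⟨ ^-swap T q K ⟩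
        (T ^ K) ^ q    ∎)

open import Data.Integer using (_+_; _*_; _-_; -_)

-- Solutions in the box as lists without repetition

solutions : ℕ → Triple → List Quad
solutions P h = filter (isSolution? h) (box P)

range-unique : ∀ P → Unique (range P)
range-unique P = Uniqueₚ.map⁺ (λ { refl → refl }) (Uniqueₚ.upTo⁺ P)

length-range : ∀ P → length (range P) ≡ P
length-range P = trans (length-map _ (upTo P)) (length-upTo P)

InRange : ℕ → ℤ → Set
InRange P x = + 1 ℤ.≤ x × x ℤ.≤ + P

∈-range⁺ : ∀ {P x} → InRange P x → x ∈ range P
∈-range⁺ {x = + suc i} (_ , +≤+ i<P) = ∈-map⁺ (λ i → + suc i) (∈-upTo⁺ i<P)
∈-range⁺ {x = + zero} (+≤+ () , _)

∈-range⁻ : ∀ {P x} → x ∈ range P → InRange P x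
∈-range⁻ x∈ with ∈-map⁻ (λ i → + suc i) x∈
... | i , i∈ , refl = +≤+ (s≤s z≤n) , +≤+ (∈-upTo⁻ i∈)

InRange⇒0< : ∀ {P x} → InRange P x → 0ℤ ℤ.< x
InRange⇒0< (1≤x , _) = ℤₚ.<-≤-trans (ℤ.+<+ (s≤s z≤n)) 1≤x

InRange⇒∣∣≤ : ∀ {P x} → InRange P x → ∣ x ∣ ℕ.≤ P
InRange⇒∣∣≤ {x = + _} (_ , +≤+ x≤P) = x≤P

0<⇒≢0 : ∀ {x} → 0ℤ ℤ.< x → x ≢ 0ℤ
0<⇒≢0 0<x refl = ℤₚ.<-irrefl refl 0<x

InBox : ℕ → Quad → Set
InBox P (x₁ , x₂ , y₁ , y₂) = InRange P x₁ × InRange P x₂ × InRange P y₁ × InRange P y₂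

∈-box⁺ : ∀ {P z} → InBox P z → z ∈ box P
∈-box⁺ (r₁ , r₂ , r₃ , r₄) =
  ∈-cartesianProduct⁺ (∈-range⁺ r₁) (∈-cartesianProduct⁺ (∈-range⁺ r₂) (∈-cartesianProduct⁺ (∈-range⁺ r₃) (∈-range⁺ r₄)))

∈-box⁻ : ∀ P {z} → z ∈ box P → InBox P z
∈-box⁻ P z∈ with ∈-cartesianProduct⁻ (range P) (cartesianProduct (range P) (cartesianProduct (range P) (range P))) z∈
... | m₁ , z∈ with ∈-cartesianProduct⁻ (range P) (cartesianProduct (range P) (range P)) z∈
... | m₂ , z∈ with ∈-cartesianProduct⁻ (range P) (range P) z∈
... | m₃ , m₄ = ∈-range⁻ m₁ , ∈-range⁻ m₂ , ∈-range⁻ m₃ , ∈-range⁻ m₄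

-- Powers are spelled out as products so that matching the equations with `refl` turns the
-- coefficients into explicit polynomials, within reach of the ring solver.
record PowerSums (h : Triple) (z : Quad) : Set where
  constructor powerSums
  x₁ = proj₁ z
  x₂ = proj₁ (proj₂ z)
  y₁ = proj₁ (proj₂ (proj₂ z))
  y₂ = proj₂ (proj₂ (proj₂ z))
  field
    sum₁ : x₁ + x₂ - y₁ - y₂ ≡ Triple.h₁ h
    sum₂ : x₁ * x₁ + x₂ * x₂ - y₁ * y₁ - y₂ * y₂ ≡ Triple.h₂ h
    sum₄ : x₁ * x₁ * (x₁ * x₁) + x₂ * x₂ * (x₂ * x₂) - y₁ * y₁ * (y₁ * y₁) - y₂ * y₂ * (y₂ * y₂) ≡ Triple.h₄ h

i^2≡i*i : ∀ i → i ℤ.^ 2 ≡ i * i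
i^2≡i*i i = cong (i *_) (ℤₚ.*-identityʳ i)

i^4≡i*i*[i*i] : ∀ i → i ℤ.^ 4 ≡ i * i * (i * i)
i^4≡i*i*[i*i] = unfolded
  where
  unfolded : ∀ i → i * (i * (i * (i * + 1))) ≡ i * i * (i * i)
  unfolded = ℤ-Solver.solve-∀

powerSum-expand : (f : ℤ → ℤ) (j : ℕ) → (∀ i → i ℤ.^ j ≡ f i) →
  ∀ x₁ x₂ y₁ y₂ → powerSum (x₁ , x₂ , y₁ , y₂) j ≡ f x₁ + f x₂ - f y₁ - f y₂
powerSum-expand f j eq x₁ x₂ y₁ y₂ =
  cong₂ _-_ (cong₂ _-_ (cong₂ _+_ (eq x₁) (eq x₂)) (eq y₁)) (eq y₂)

isSolution⇒powerSums : ∀ h z → IsSolution h z → PowerSums h z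
isSolution⇒powerSums _ (x₁ , x₂ , y₁ , y₂) (e₁ , e₂ , e₄) = powerSums
  (trans (sym (powerSum-expand (λ i → i) 1 ℤₚ.^-identityʳ x₁ x₂ y₁ y₂)) e₁)
  (trans (sym (powerSum-expand (λ i → i * i) 2 i^2≡i*i x₁ x₂ y₁ y₂)) e₂)
  (trans (sym (powerSum-expand (λ i → i * i * (i * i)) 4 i^4≡i*i*[i*i] x₁ x₂ y₁ y₂)) e₄)

∈-solutions⁻ : ∀ P {h z} → z ∈ solutions P h → InBox P z × PowerSums h z
∈-solutions⁻ P {h} {z} z∈ with ∈-filter⁻ (isSolution? h) {xs = box P} z∈
... | z∈box , sol = ∈-box⁻ P z∈box , isSolution⇒powerSums h z sol

∈-solutions⁺ : ∀ P {h z} → InBox P z → IsSolution h z → z ∈ solutions P h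
∈-solutions⁺ P {h} inBox sol = ∈-filter⁺ (isSolution? h) (∈-box⁺ inBox) sol

box-unique : ∀ P → Unique (box P)
box-unique P = Uniqueₚ.cartesianProduct⁺ r! (Uniqueₚ.cartesianProduct⁺ r! (Uniqueₚ.cartesianProduct⁺ r! r!))
  where r! = range-unique P

solutions-unique : ∀ P h → Unique (solutions P h)
solutions-unique P h = Uniqueₚ.filter⁺ (isSolution? h) (box-unique P)

-- Counting solutions by divisors

_∣ᶻ_ : ℤ → ℤ → Set
d ∣ᶻ D = ∣ d ∣ ℕᵈ.∣ ∣ D ∣

factor⇒∣ : ∀ {D} d e → D ≡ d * e → d ∣ᶻ D
factor⇒∣ d e refl = subst (∣ d ∣ ℕᵈ.∣_) (sym (ℤₚ.abs-* d e)) (ℕᵈ.m∣m*n ∣ e ∣)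

_∣⁴_ : Quad → ℤ → Set
(a , b , c , d) ∣⁴ D = a ∣ᶻ D × b ∣ᶻ D × c ∣ᶻ D × d ∣ᶻ D

signed : List ℕ → List ℤ
signed L = map +_ L ++ map (λ n → - + n) L

∈-signed : ∀ {L} i → ∣ i ∣ ∈ L → i ∈ signed L
∈-signed     (+ n)     n∈L = ∈-++⁺ˡ (∈-map⁺ +_ n∈L)
∈-signed {L} -[1+ n ] n∈L = ∈-++⁺ʳ (map +_ L) (∈-map⁺ (λ n → - + n) n∈L)

length-signed : ∀ L → length (signed L) ≡ 2 ℕ.* length L
length-signed L = begin
  length (signed L)                                      ≡⟨ length-++ (map +_ L) ⟩
  length (map +_ L) ℕ.+ length (map (λ n → - + n) L)     ≡⟨ cong₂ ℕ._+_ (length-map _ L) (length-map _ L) ⟩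
  length L ℕ.+ length L                                  ≡⟨ cong (length L ℕ.+_) (sym (ℕₚ.+-identityʳ _)) ⟩
  2 ℕ.* length L                                         ∎
  where open ≡-Reasoning

-- A certificate for T ≪ P^ε: the solutions inject into quadruples of divisors of one nonzero
-- integer of polynomial size. The bound is the one for `M`, which has degree 6 in the variables;
-- the cases with `D` = 3 h₂ fit under it. Codes with two essential entries repeat them to fill four
-- slots.
record DivisorCode (P : ℕ) (h : Triple) : Set where
  field
    D         : ℤ
    code      : Quad → Quad
    D≢0       : D ≢ 0ℤ
    ∣D∣≤      : ∣ D ∣ ℕ.≤ P ℕ.^ 6 ℕ.* 1216
    divides   : ∀ {z} → z ∈ solutions P h → code z ∣⁴ D
    injective : ∀ {z z′} → z ∈ solutions P h → z′ ∈ solutions P h → code z ≡ code z′ → z ≡ z′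

few-solutions : ∀ K .{{_ : NonZero K}} →
  ∃[ C ] (∀ P h → DivisorCode P h → T₂ P h ℕ.^ K ℕ.≤ C ℕ.* P)
-- Four divisors per solution and a `D` of order P^6 account for k = 24 K: T^(6 K) ≤ (2 ℓ)^(24 K) ≪
-- P^6, where 2 ℓ counts signed divisors. A sixth root finishes.
few-solutions K with divisorBound (4 ℕ.* (K ℕ.* 6)) {{ℕₚ.m*n≢0 4 (K ℕ.* 6) {{_}} {{ℕₚ.m*n≢0 K 6}}}}
... | C , few = C₁ , bound
  where
  k = 4 ℕ.* (K ℕ.* 6)
  C₁ = 2 ℕ.^ k ℕ.* C ℕ.* 1216
  bound : ∀ P h → DivisorCode P h → T₂ P h ℕ.^ K ℕ.≤ C₁ ℕ.* P
  bound P h dc with few ∣ DivisorCode.D dc ∣ {{ℕ.≢-nonZero (λ ∣D∣≡0 → DivisorCode.D≢0 dc (ℤₚ.∣i∣≡0⇒i≡0 ∣D∣≡0))}}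
  ... | L , covers , len = ^-cancelˡ-≤ 6 (begin
    (T₂ P h ℕ.^ K) ℕ.^ 6               ≡⟨ ℕₚ.^-*-assoc (T₂ P h) K 6 ⟩
    T₂ P h ℕ.^ (K ℕ.* 6)               ≤⟨ ℕₚ.^-monoˡ-≤ (K ℕ.* 6) T≤ ⟩
    ((2 ℕ.* ℓ) ℕ.^ 4) ℕ.^ (K ℕ.* 6)    ≡⟨ ℕₚ.^-*-assoc (2 ℕ.* ℓ) 4 (K ℕ.* 6) ⟩
    (2 ℕ.* ℓ) ℕ.^ k                    ≡⟨ ^-distribʳ-* k 2 ℓ ⟩
    2 ℕ.^ k ℕ.* ℓ ℕ.^ k                ≤⟨ ℕₚ.*-monoʳ-≤ (2 ℕ.^ k) (ℕₚ.≤-trans len (ℕₚ.*-monoʳ-≤ C ∣D∣≤)) ⟩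
    2 ℕ.^ k ℕ.* (C ℕ.* (P ℕ.^ 6 ℕ.* 1216)) ≡⟨ reassoc (2 ℕ.^ k) C (P ℕ.^ 6) 1216 ⟩
    C₁ ℕ.* P ℕ.^ 6                     ≤⟨ ℕₚ.*-monoˡ-≤ (P ℕ.^ 6) (m≤m^k 6 C₁) ⟩
    C₁ ℕ.^ 6 ℕ.* P ℕ.^ 6               ≡⟨ sym (^-distribʳ-* 6 C₁ P) ⟩
    (C₁ ℕ.* P) ℕ.^ 6                   ∎)
    where
    open ℕₚ.≤-Reasoning
    open DivisorCode dc
    ℓ = length L
    S = signed L
    reassoc : ∀ x y z w → x ℕ.* (y ℕ.* (z ℕ.* w)) ≡ x ℕ.* y ℕ.* w ℕ.* z
    reassoc = ℕ-Solver.solve-∀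
    into : ∀ {z} → z ∈ solutions P h → code z ∈ cartesianProduct S (cartesianProduct S (cartesianProduct S S))
    into z∈ with divides z∈
    ... | d₁ , d₂ , d₃ , d₄ =
      ∈-cartesianProduct⁺ (∈-signed _ (covers d₁)) (∈-cartesianProduct⁺ (∈-signed _ (covers d₂))
        (∈-cartesianProduct⁺ (∈-signed _ (covers d₃)) (∈-signed _ (covers d₄))))
    T≤ : T₂ P h ℕ.≤ (2 ℕ.* ℓ) ℕ.^ 4
    T≤ = begin
      T₂ P h   ≤⟨ length-injection (solutions-unique P h) injective into ⟩
      length (cartesianProduct S (cartesianProduct S (cartesianProduct S S)))
        ≡⟨ trans (length-cartesianProduct S _) (cong (length S ℕ.*_) (trans (length-cartesianProduct S _)
             (cong (length S ℕ.*_) (length-cartesianProduct S S)))) ⟩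
      length S ℕ.* (length S ℕ.* (length S ℕ.* length S))
        ≡⟨ cong (λ n → length S ℕ.* (length S ℕ.* (length S ℕ.* n))) (sym (ℕₚ.*-identityʳ (length S))) ⟩
      length S ℕ.^ 4       ≡⟨ cong (ℕ._^ 4) (length-signed L) ⟩
      (2 ℕ.* ℓ) ℕ.^ 4      ∎

-- Factorisations of M and of h₂

private module ℤ-Group = GroupProperties (AbelianGroup.group ℤₚ.+-0-abelianGroup)

-- Let a, b be the rationals with a - b = h₁ and a² - b² = h₂.  Then X h x = 2 h₁ (x - a),
-- Y h y = 2 h₁ (y - b), and M h is 2 h₁² (a⁴ - b⁴ - h₄).
M : Triple → ℤ
M (triple h₁ h₂ h₄) = h₂ * h₂ * h₂ + h₁ * h₁ * h₁ * h₁ * h₂ - + 2 * h₁ * h₁ * h₄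

-- On a solution with h₁ ≠ 0, and a, b as above, this is 2 h₁ (x₁ + x₂ + b) = 2 h₁ (y₁ + y₂ + a).
W : Triple → Quad → ℤ
W (triple h₁ h₂ h₄) (x₁ , x₂ , y₁ , y₂) = h₂ + h₁ * (x₁ + x₂ + y₁ + y₂)

X Y : Triple → ℤ → ℤ
X (triple h₁ h₂ h₄) x = + 2 * h₁ * x - (h₁ * h₁ + h₂)
Y (triple h₁ h₂ h₄) y = + 2 * h₁ * y - (h₂ - h₁ * h₁)

-- The monic cubics with roots x₁, x₂, b and y₁, y₂, a differ by a constant, which at a equals (a -
-- x₁) (a - x₂) (a - b). By Newton's identities the sums of fourth powers differ by 4 times the
-- common sum of the roots times the difference of the products of the roots. Clearing denominators
-- gives the factorisation, a polynomial identity.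
M-factor-x : ∀ {h x₁ x₂ y₁ y₂} → PowerSums h (x₁ , x₂ , y₁ , y₂) →
  M h ≡ W h (x₁ , x₂ , y₁ , y₂) * (X h x₁ * X h x₂)
M-factor-x {x₁ = x₁} {x₂} {y₁} {y₂} (powerSums refl refl refl) = identity x₁ x₂ y₁ y₂
  where
  identity : ∀ x₁ x₂ y₁ y₂ → let
    h₁ = x₁ + x₂ - y₁ - y₂
    h₂ = x₁ * x₁ + x₂ * x₂ - y₁ * y₁ - y₂ * y₂
    h₄ = x₁ * x₁ * (x₁ * x₁) + x₂ * x₂ * (x₂ * x₂) - y₁ * y₁ * (y₁ * y₁) - y₂ * y₂ * (y₂ * y₂)
    in h₂ * h₂ * h₂ + h₁ * h₁ * h₁ * h₁ * h₂ - + 2 * h₁ * h₁ * h₄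
     ≡ (h₂ + h₁ * (x₁ + x₂ + y₁ + y₂))
       * ((+ 2 * h₁ * x₁ - (h₁ * h₁ + h₂)) * (+ 2 * h₁ * x₂ - (h₁ * h₁ + h₂)))
  identity = ℤ-Solver.solve-∀

-- The same two cubics, compared at b instead of a.
M-factor-y : ∀ {h x₁ x₂ y₁ y₂} → PowerSums h (x₁ , x₂ , y₁ , y₂) →
  M h ≡ W h (x₁ , x₂ , y₁ , y₂) * (Y h y₁ * Y h y₂)
M-factor-y {x₁ = x₁} {x₂} {y₁} {y₂} (powerSums refl refl refl) = identity x₁ x₂ y₁ y₂
  where
  identity : ∀ x₁ x₂ y₁ y₂ → let
    h₁ = x₁ + x₂ - y₁ - y₂
    h₂ = x₁ * x₁ + x₂ * x₂ - y₁ * y₁ - y₂ * y₂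
    h₄ = x₁ * x₁ * (x₁ * x₁) + x₂ * x₂ * (x₂ * x₂) - y₁ * y₁ * (y₁ * y₁) - y₂ * y₂ * (y₂ * y₂)
    in h₂ * h₂ * h₂ + h₁ * h₁ * h₁ * h₁ * h₂ - + 2 * h₁ * h₁ * h₄
     ≡ (h₂ + h₁ * (x₁ + x₂ + y₁ + y₂))
       * ((+ 2 * h₁ * y₁ - (h₂ - h₁ * h₁)) * (+ 2 * h₁ * y₂ - (h₂ - h₁ * h₁)))
  identity = ℤ-Solver.solve-∀

i*j≢0 : ∀ {i j} → i ≢ 0ℤ → j ≢ 0ℤ → i * j ≢ 0ℤ
i*j≢0 {i} i≢0 j≢0 i*j≡0 = [ i≢0 , j≢0 ]′ (ℤₚ.i*j≡0⇒i≡0∨j≡0 i i*j≡0)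

*-cancel : ∀ {i j k} → i ≢ 0ℤ → i * j ≡ i * k → j ≡ k
*-cancel {i} {j} {k} i≢0 = ℤₚ.*-cancelˡ-≡ i j k {{ℤ.≢-nonZero i≢0}}

*-cancel-0 : ∀ i {j} → i ≢ 0ℤ → i * j ≡ 0ℤ → j ≡ 0ℤ
*-cancel-0 i i≢0 i*j≡0 = [ (λ i≡0 → contradiction i≡0 i≢0) , (λ j≡0 → j≡0) ]′ (ℤₚ.i*j≡0⇒i≡0∨j≡0 i i*j≡0)

drop-0 : ∀ {i j k} → i ≡ j + k → k ≡ 0ℤ → i ≡ j
drop-0 {j = j} i≡j+k refl = trans i≡j+k (ℤₚ.+-identityʳ j)

Quad-≡ : ∀ {a b c d a′ b′ c′ d′ : ℤ} → a ≡ a′ → b ≡ b′ → c ≡ c′ → d ≡ d′ →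
  _≡_ {A = Quad} (a , b , c , d) (a′ , b′ , c′ , d′)
Quad-≡ refl refl refl refl = refl

Quad-≡⁻ : ∀ {a b c d a′ b′ c′ d′ : ℤ} → _≡_ {A = Quad} (a , b , c , d) (a′ , b′ , c′ , d′) →
  a ≡ a′ × b ≡ b′ × c ≡ c′ × d ≡ d′
Quad-≡⁻ refl = refl , refl , refl , refl

-- Size of the coefficients

∣i+j-k-l∣≤4*n : ∀ i j k l {n} → ∣ i ∣ ℕ.≤ n → ∣ j ∣ ℕ.≤ n → ∣ k ∣ ℕ.≤ n → ∣ l ∣ ℕ.≤ n →
  ∣ i + j - k - l ∣ ℕ.≤ 4 ℕ.* n
∣i+j-k-l∣≤4*n i j k l {n} i≤ j≤ k≤ l≤ = begin
  ∣ i + j - k - l ∣                          ≤⟨ ℤₚ.∣i-j∣≤∣i∣+∣j∣ (i + j - k) l ⟩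
  ∣ i + j - k ∣ ℕ.+ ∣ l ∣                    ≤⟨ ℕₚ.+-monoˡ-≤ ∣ l ∣ (ℤₚ.∣i-j∣≤∣i∣+∣j∣ (i + j) k) ⟩
  ∣ i + j ∣ ℕ.+ ∣ k ∣ ℕ.+ ∣ l ∣              ≤⟨ ℕₚ.+-monoˡ-≤ ∣ l ∣ (ℕₚ.+-monoˡ-≤ ∣ k ∣ (ℤₚ.∣i+j∣≤∣i∣+∣j∣ i j)) ⟩
  ∣ i ∣ ℕ.+ ∣ j ∣ ℕ.+ ∣ k ∣ ℕ.+ ∣ l ∣        ≤⟨ ℕₚ.+-mono-≤ (ℕₚ.+-mono-≤ (ℕₚ.+-mono-≤ i≤ j≤) k≤) l≤ ⟩
  n ℕ.+ n ℕ.+ n ℕ.+ n                        ≡⟨ fourfold n ⟩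
  4 ℕ.* n                                    ∎
  where
  open ℕₚ.≤-Reasoning
  fourfold : ∀ n → n ℕ.+ n ℕ.+ n ℕ.+ n ≡ 4 ℕ.* n
  fourfold = ℕ-Solver.solve-∀

∣i*j∣≤ : ∀ i j {m n} → ∣ i ∣ ℕ.≤ m → ∣ j ∣ ℕ.≤ n → ∣ i * j ∣ ℕ.≤ m ℕ.* n
∣i*j∣≤ i j i≤ j≤ = subst (ℕ._≤ _) (sym (ℤₚ.abs-* i j)) (ℕₚ.*-mono-≤ i≤ j≤)

record Small (P : ℕ) (h : Triple) : Set where
  constructor small
  open Triple h
  field
    ∣h₁∣≤ : ∣ h₁ ∣ ℕ.≤ 4 ℕ.* P
    ∣h₂∣≤ : ∣ h₂ ∣ ℕ.≤ 4 ℕ.* (P ℕ.* P)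
    ∣h₄∣≤ : ∣ h₄ ∣ ℕ.≤ 4 ℕ.* (P ℕ.* P ℕ.* (P ℕ.* P))

-- The coefficients are arbitrary a priori; it is the existence of one solution that bounds them,
-- which is why each divisor code is built from a given solution.
powerSums-small : ∀ P h z → InBox P z → PowerSums h z → Small P h
powerSums-small P _ (x₁ , x₂ , y₁ , y₂) (r₁ , r₂ , r₃ , r₄) (powerSums refl refl refl) = small
  (∣i+j-k-l∣≤4*n x₁ x₂ y₁ y₂ (InRange⇒∣∣≤ r₁) (InRange⇒∣∣≤ r₂) (InRange⇒∣∣≤ r₃) (InRange⇒∣∣≤ r₄))
  (∣i+j-k-l∣≤4*n (x₁ * x₁) (x₂ * x₂) (y₁ * y₁) (y₂ * y₂) (sq x₁ r₁) (sq x₂ r₂) (sq y₁ r₃) (sq y₂ r₄))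
  (∣i+j-k-l∣≤4*n (x₁ * x₁ * (x₁ * x₁)) (x₂ * x₂ * (x₂ * x₂)) (y₁ * y₁ * (y₁ * y₁)) (y₂ * y₂ * (y₂ * y₂))
    (fourth x₁ r₁) (fourth x₂ r₂) (fourth y₁ r₃) (fourth y₂ r₄))
  where
  sq : ∀ x → InRange P x → ∣ x * x ∣ ℕ.≤ P ℕ.* P
  sq x r = ∣i*j∣≤ x x (InRange⇒∣∣≤ r) (InRange⇒∣∣≤ r)
  fourth : ∀ x → InRange P x → ∣ x * x * (x * x) ∣ ℕ.≤ P ℕ.* P ℕ.* (P ℕ.* P)
  fourth x r = ∣i*j∣≤ (x * x) (x * x) (sq x r) (sq x r)

-- 1216 = 4³ + 4⁵ + 2·4³, one summand for each term of M.
∣M∣≤ : ∀ P h → Small P h → ∣ M h ∣ ℕ.≤ P ℕ.^ 6 ℕ.* 1216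
∣M∣≤ P (triple h₁ h₂ h₄) (small b₁ b₂ b₄) = begin
  ∣ A + B - C ∣                  ≤⟨ ℤₚ.∣i-j∣≤∣i∣+∣j∣ (A + B) C ⟩
  ∣ A + B ∣ ℕ.+ ∣ C ∣            ≤⟨ ℕₚ.+-monoˡ-≤ ∣ C ∣ (ℤₚ.∣i+j∣≤∣i∣+∣j∣ A B) ⟩
  ∣ A ∣ ℕ.+ ∣ B ∣ ℕ.+ ∣ C ∣      ≤⟨ ℕₚ.+-mono-≤ (ℕₚ.+-mono-≤
      (∣i*j∣≤ (h₂ * h₂) h₂ (∣i*j∣≤ h₂ h₂ b₂ b₂) b₂)
      (∣i*j∣≤ (h₁ * h₁ * h₁ * h₁) h₂ (∣i*j∣≤ (h₁ * h₁ * h₁) h₁ (∣i*j∣≤ (h₁ * h₁) h₁ (∣i*j∣≤ h₁ h₁ b₁ b₁) b₁) b₁) b₂))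
      (∣i*j∣≤ (+ 2 * h₁ * h₁) h₄ (∣i*j∣≤ (+ 2 * h₁) h₁ (∣i*j∣≤ (+ 2) h₁ ℕₚ.≤-refl b₁) b₁) b₄) ⟩
  _                              ≡⟨ total P ⟩
  P ℕ.^ 6 ℕ.* 1216               ∎
  where
  open ℕₚ.≤-Reasoning
  A = h₂ * h₂ * h₂
  B = h₁ * h₁ * h₁ * h₁ * h₂
  C = + 2 * h₁ * h₁ * h₄
  total : ∀ P → let p₁ = 4 ℕ.* P ; p₂ = 4 ℕ.* (P ℕ.* P) ; p₄ = 4 ℕ.* (P ℕ.* P ℕ.* (P ℕ.* P)) in
    p₂ ℕ.* p₂ ℕ.* p₂ ℕ.+ p₁ ℕ.* p₁ ℕ.* p₁ ℕ.* p₁ ℕ.* p₂ ℕ.+ 2 ℕ.* p₁ ℕ.* p₁ ℕ.* p₄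
      ≡ P ℕ.* (P ℕ.* (P ℕ.* (P ℕ.* (P ℕ.* (P ℕ.* 1))))) ℕ.* 1216
  total = ℕ-Solver.solve-∀

∣3*h₂∣≤ : ∀ P .{{_ : NonZero P}} h → Small P h → ∣ + 3 * Triple.h₂ h ∣ ℕ.≤ P ℕ.^ 6 ℕ.* 1216
∣3*h₂∣≤ P (triple h₁ h₂ h₄) (small b₁ b₂ b₄) = begin
  ∣ + 3 * h₂ ∣               ≤⟨ ∣i*j∣≤ (+ 3) h₂ ℕₚ.≤-refl b₂ ⟩
  3 ℕ.* (4 ℕ.* (P ℕ.* P))    ≡⟨ total P ⟩
  P ℕ.^ 2 ℕ.* 12             ≤⟨ ℕₚ.*-mono-≤ (ℕₚ.^-monoʳ-≤ P (s≤s (s≤s (z≤n {4})))) (ℕₚ.m≤m+n 12 1204) ⟩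
  P ℕ.^ 6 ℕ.* 1216           ∎
  where
  open ℕₚ.≤-Reasoning
  total : ∀ P → 3 ℕ.* (4 ℕ.* (P ℕ.* P)) ≡ P ℕ.* (P ℕ.* 1) ℕ.* 12
  total = ℕ-Solver.solve-∀

-- The case of nonzero h₁ and M

module _ {h₁ h₂ h₄ : ℤ} (h₁≢0 : h₁ ≢ 0ℤ) where

  private
    h : Triple
    h = triple h₁ h₂ h₄
    2h₁≢0 : + 2 * h₁ ≢ 0ℤ
    2h₁≢0 = i*j≢0 {+ 2} (λ ()) h₁≢0

  X-injective : ∀ {x x′} → X h x ≡ X h x′ → x ≡ x′
  X-injective {x} {x′} eq = *-cancel 2h₁≢0 (ℤ-Group.∙-cancelʳ (- (h₁ * h₁ + h₂)) (+ 2 * h₁ * x) (+ 2 * h₁ * x′) eq)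

  Y-injective : ∀ {y y′} → Y h y ≡ Y h y′ → y ≡ y′
  Y-injective {y} {y′} eq = *-cancel 2h₁≢0 (ℤ-Group.∙-cancelʳ (- (h₂ - h₁ * h₁)) (+ 2 * h₁ * y) (+ 2 * h₁ * y′) eq)

  linearCode : Quad → Quad
  linearCode (x₁ , x₂ , y₁ , y₂) = X h x₁ , X h x₂ , Y h y₁ , Y h y₂

  linearCode-injective : ∀ z z′ → linearCode z ≡ linearCode z′ → z ≡ z′
  linearCode-injective z z′ eq with Quad-≡⁻ eq
  ... | e₁ , e₂ , e₃ , e₄ = Quad-≡ (X-injective e₁) (X-injective e₂) (Y-injective e₃) (Y-injective e₄)

  linearCode-divides : ∀ z → PowerSums h z → linearCode z ∣⁴ M h
  linearCode-divides z@(x₁ , x₂ , y₁ , y₂) s =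
      factor⇒∣ (X h x₁) (w * X h x₂) (trans (M-factor-x s) (rotate₁ w (X h x₁) (X h x₂)))
    , factor⇒∣ (X h x₂) (w * X h x₁) (trans (M-factor-x s) (rotate₂ w (X h x₁) (X h x₂)))
    , factor⇒∣ (Y h y₁) (w * Y h y₂) (trans (M-factor-y s) (rotate₁ w (Y h y₁) (Y h y₂)))
    , factor⇒∣ (Y h y₂) (w * Y h y₁) (trans (M-factor-y s) (rotate₂ w (Y h y₁) (Y h y₂)))
    where
    w = W h z
    rotate₁ : ∀ a b c → a * (b * c) ≡ b * (a * c)
    rotate₁ = ℤ-Solver.solve-∀
    rotate₂ : ∀ a b c → a * (b * c) ≡ c * (a * b)
    rotate₂ = ℤ-Solver.solve-∀

-- The case M = 0 with a solution where W ≠ 0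

a-b≡h₁ : ∀ {h₁ h₂ h₄} a b → h₁ ≢ 0ℤ →
  X (triple h₁ h₂ h₄) a ≡ 0ℤ → Y (triple h₁ h₂ h₄) b ≡ 0ℤ → a - b ≡ h₁
a-b≡h₁ {h₁} {h₂} a b h₁≢0 X≡0 Y≡0 =
  ℤₚ.i-j≡0⇒i≡j (a - b) h₁ (*-cancel-0 (+ 2 * h₁) (i*j≢0 {+ 2} (λ ()) h₁≢0)
    (trans (identity h₁ h₂ a b) (cong₂ _-_ X≡0 Y≡0)))
  where
  identity : ∀ h₁ h₂ a b → + 2 * h₁ * (a - b - h₁)
    ≡ (+ 2 * h₁ * a - (h₁ * h₁ + h₂)) - (+ 2 * h₁ * b - (h₂ - h₁ * h₁))
  identity = ℤ-Solver.solve-∀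

-- Once a - b = h₁, the equation X = 0 at a reads a² - b² = h₂, and then M = 0 reads 2 h₁² (a⁴ - b⁴
-- - h₄) = 0.
differences : ∀ {h₁ h₂ h₄} a b → h₁ ≢ 0ℤ → M (triple h₁ h₂ h₄) ≡ 0ℤ →
  X (triple h₁ h₂ h₄) a ≡ 0ℤ → a - b ≡ h₁ →
  (a * a - b * b ≡ h₂) × (a * a * (a * a) - b * b * (b * b) ≡ h₄)
differences {h₂ = h₂} {h₄} a b h₁≢0 M≡0 X≡0 refl = a²-b²≡h₂ , sym (fourth M≡0 (sym a²-b²≡h₂))
  where
  a²-b²≡h₂ : a * a - b * b ≡ h₂
  a²-b²≡h₂ = ℤₚ.i-j≡0⇒i≡j (a * a - b * b) h₂ (trans (identity a b h₂) X≡0)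
    where
    identity : ∀ a b h₂ → a * a - b * b - h₂ ≡ + 2 * (a - b) * a - ((a - b) * (a - b) + h₂)
    identity = ℤ-Solver.solve-∀
  fourth : M (triple (a - b) h₂ h₄) ≡ 0ℤ → h₂ ≡ a * a - b * b → h₄ ≡ a * a * (a * a) - b * b * (b * b)
  fourth M≡0 refl = sym (ℤₚ.i-j≡0⇒i≡j _ h₄ (*-cancel-0 (+ 2 * (a - b) * (a - b))
    (i*j≢0 (i*j≢0 {+ 2} (λ ()) h₁≢0) h₁≢0) (trans (identity a b h₄) M≡0)))
    where
    identity : ∀ a b h₄ → let h₁ = a - b ; h₂ = a * a - b * b in
      + 2 * (a - b) * (a - b) * (a * a * (a * a) - b * b * (b * b) - h₄)
      ≡ h₂ * h₂ * h₂ + h₁ * h₁ * h₁ * h₁ * h₂ - + 2 * h₁ * h₁ * h₄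
    identity = ℤ-Solver.solve-∀

-- After cancelling `W`, both factorisations have a vanishing linear factor. Its root is a
-- coordinate of the solution, so a and b are integers in the range; they differ because h₁ ≠ 0.
W≢0⇒conditionA : ∀ P h z → Triple.h₁ h ≢ 0ℤ → M h ≡ 0ℤ →
  InBox P z → PowerSums h z → W h z ≢ 0ℤ → ConditionA P h
W≢0⇒conditionA P h@(triple h₁ h₂ h₄) z@(x₁ , x₂ , y₁ , y₂) h₁≢0 M≡0 (r₁ , r₂ , r₃ , r₄) s W≢0
  with root (X h) r₁ r₂ (M-factor-x s) | root (Y h) r₃ r₄ (M-factor-y s)
  where
  root : ∀ (f : ℤ → ℤ) {i j} → InRange P i → InRange P j → M h ≡ W h z * (f i * f j) →
         ∃[ k ] (InRange P k × f k ≡ 0ℤ)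
  root f {i} {j} ri rj M≡ with ℤₚ.i*j≡0⇒i≡0∨j≡0 (f i) (*-cancel-0 (W h z) W≢0 (trans (sym M≡) M≡0))
  ... | inj₁ fi≡0 = i , ri , fi≡0
  ... | inj₂ fj≡0 = j , rj , fj≡0
... | a , (1≤a , a≤P) , X≡0 | b , (1≤b , b≤P) , Y≡0
  with a-b≡h₁ {h₁} {h₂} {h₄} a b h₁≢0 X≡0 Y≡0
... | a-b≡ with differences {h₁} {h₂} {h₄} a b h₁≢0 M≡0 X≡0 a-b≡
... | a²-b²≡ , a⁴-b⁴≡ =
  a , b , (λ a≡b → h₁≢0 (trans (sym a-b≡) (ℤₚ.i≡j⇒i-j≡0 a≡b))) , 1≤a , a≤P , 1≤b , b≤P
  , trans (cong₂ _-_ (ℤₚ.^-identityʳ a) (ℤₚ.^-identityʳ b)) a-b≡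
  , trans (cong₂ _-_ (i^2≡i*i a) (i^2≡i*i b)) a²-b²≡
  , trans (cong₂ _-_ (i^4≡i*i*[i*i] a) (i^4≡i*i*[i*i] b)) a⁴-b⁴≡

-- The case where W vanishes at every solution

p q : Quad → ℤ
p (x₁ , x₂ , y₁ , y₂) = (y₁ - y₂) - (x₁ - x₂)
q (x₁ , x₂ , y₁ , y₂) = (y₁ - y₂) + (x₁ - x₂)

gapCode : Quad → Quad
gapCode z = p z , q z , p z , q z

module _ {h : Triple} (h₁≢0 : Triple.h₁ h ≢ 0ℤ) where
  private
    h₁ = Triple.h₁ h
    h₂ = Triple.h₂ h

  -- The parallelogram law gives 2 h₂ = h₁ (x₁ + x₂ + y₁ + y₂) + (x₁ - x₂)² - (y₁ - y₂)², and the
  -- first term on the right is W - h₂.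
  gap-product : ∀ {z} → PowerSums h z → + 3 * h₂ ≡ p z * (- q z) + W h z
  gap-product {x₁ , x₂ , y₁ , y₂} (powerSums refl refl refl) = identity x₁ x₂ y₁ y₂
    where
    identity : ∀ x₁ x₂ y₁ y₂ → let
      h₁ = x₁ + x₂ - y₁ - y₂
      h₂ = x₁ * x₁ + x₂ * x₂ - y₁ * y₁ - y₂ * y₂ in
      + 3 * h₂ ≡ ((y₁ - y₂) - (x₁ - x₂)) * (- ((y₁ - y₂) + (x₁ - x₂))) + (h₂ + h₁ * (x₁ + x₂ + y₁ + y₂))
    identity = ℤ-Solver.solve-∀

  gapCode-divides : ∀ z → PowerSums h z → W h z ≡ 0ℤ → gapCode z ∣⁴ (+ 3 * h₂)
  gapCode-divides z s W≡0 = p∣ , q∣ , p∣ , q∣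
    where
    p∣ = factor⇒∣ (p z) (- q z) (drop-0 (gap-product s) W≡0)
    swap : ∀ p q → p * (- q) ≡ q * (- p)
    swap = ℤ-Solver.solve-∀
    q∣ = factor⇒∣ (q z) (- p z) (trans (drop-0 (gap-product s) W≡0) (swap (p z) (q z)))

  -- If h₂ were 0, then W would be h₁ times a sum of four positive integers.
  3*h₂≢0 : ∀ P z → InBox P z → PowerSums h z → W h z ≡ 0ℤ → + 3 * h₂ ≢ 0ℤ
  3*h₂≢0 P (x₁ , x₂ , y₁ , y₂) (r₁ , r₂ , r₃ , r₄) s W≡0 3*h₂≡0 =
    i*j≢0 h₁≢0 (0<⇒≢0 (ℤₚ.+-mono-< (ℤₚ.+-mono-< (ℤₚ.+-mono-< (InRange⇒0< r₁) (InRange⇒0< r₂)) (InRange⇒0< r₃)) (InRange⇒0< r₄)))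
      (trans (sym (ℤₚ.+-identityˡ _)) (trans (cong (_+ h₁ * (x₁ + x₂ + y₁ + y₂)) (sym h₂≡0)) W≡0))
    where
    h₂≡0 : h₂ ≡ 0ℤ
    h₂≡0 = *-cancel-0 (+ 3) (λ ()) 3*h₂≡0

  -- The two differences, h₁ and the total x₁ + x₂ + y₁ + y₂ determine all coordinates; W = 0 fixes
  -- the total as - h₂ / h₁. The factor 4 h₁ clears the denominators.
  4*h₁*coordinate : ∀ {x₁ x₂ y₁ y₂} → let z = (x₁ , x₂ , y₁ , y₂) in PowerSums h z →
      + 4 * h₁ * x₁ ≡ (h₁ * h₁ - h₂ + h₁ * (q z - p z)) + W h z
    × + 4 * h₁ * x₂ ≡ (h₁ * h₁ - h₂ - h₁ * (q z - p z)) + W h z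
    × + 4 * h₁ * y₁ ≡ (- (h₁ * h₁) - h₂ + h₁ * (q z + p z)) + W h z
    × + 4 * h₁ * y₂ ≡ (- (h₁ * h₁) - h₂ - h₁ * (q z + p z)) + W h z
  4*h₁*coordinate {x₁} {x₂} {y₁} {y₂} (powerSums refl sum₂ sum₄) =
    i₁ x₁ x₂ y₁ y₂ h₂ , i₂ x₁ x₂ y₁ y₂ h₂ , i₃ x₁ x₂ y₁ y₂ h₂ , i₄ x₁ x₂ y₁ y₂ h₂
    where
    i₁ : ∀ x₁ x₂ y₁ y₂ h₂ → let h₁ = x₁ + x₂ - y₁ - y₂ ; p = (y₁ - y₂) - (x₁ - x₂) ; q = (y₁ - y₂) + (x₁ - x₂) in
      + 4 * h₁ * x₁ ≡ (h₁ * h₁ - h₂ + h₁ * (q - p)) + (h₂ + h₁ * (x₁ + x₂ + y₁ + y₂))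
    i₁ = ℤ-Solver.solve-∀
    i₂ : ∀ x₁ x₂ y₁ y₂ h₂ → let h₁ = x₁ + x₂ - y₁ - y₂ ; p = (y₁ - y₂) - (x₁ - x₂) ; q = (y₁ - y₂) + (x₁ - x₂) in
      + 4 * h₁ * x₂ ≡ (h₁ * h₁ - h₂ - h₁ * (q - p)) + (h₂ + h₁ * (x₁ + x₂ + y₁ + y₂))
    i₂ = ℤ-Solver.solve-∀
    i₃ : ∀ x₁ x₂ y₁ y₂ h₂ → let h₁ = x₁ + x₂ - y₁ - y₂ ; p = (y₁ - y₂) - (x₁ - x₂) ; q = (y₁ - y₂) + (x₁ - x₂) in
      + 4 * h₁ * y₁ ≡ (- (h₁ * h₁) - h₂ + h₁ * (q + p)) + (h₂ + h₁ * (x₁ + x₂ + y₁ + y₂))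
    i₃ = ℤ-Solver.solve-∀
    i₄ : ∀ x₁ x₂ y₁ y₂ h₂ → let h₁ = x₁ + x₂ - y₁ - y₂ ; p = (y₁ - y₂) - (x₁ - x₂) ; q = (y₁ - y₂) + (x₁ - x₂) in
      + 4 * h₁ * y₂ ≡ (- (h₁ * h₁) - h₂ - h₁ * (q + p)) + (h₂ + h₁ * (x₁ + x₂ + y₁ + y₂))
    i₄ = ℤ-Solver.solve-∀

  gapCode-injective : ∀ z z′ → PowerSums h z → PowerSums h z′ → W h z ≡ 0ℤ → W h z′ ≡ 0ℤ →
    gapCode z ≡ gapCode z′ → z ≡ z′
  gapCode-injective z z′ s s′ W≡0 W′≡0 eq
    with 4*h₁*coordinate s | 4*h₁*coordinate s′ | Quad-≡⁻ eq
  ... | e₁ , e₂ , e₃ , e₄ | e₁′ , e₂′ , e₃′ , e₄′ | p≡ , q≡ , _ =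
    Quad-≡ (same (cong₂ (λ p q → h₁ * h₁ - h₂ + h₁ * (q - p)) p≡ q≡) e₁ e₁′)
           (same (cong₂ (λ p q → h₁ * h₁ - h₂ - h₁ * (q - p)) p≡ q≡) e₂ e₂′)
           (same (cong₂ (λ p q → - (h₁ * h₁) - h₂ + h₁ * (q + p)) p≡ q≡) e₃ e₃′)
           (same (cong₂ (λ p q → - (h₁ * h₁) - h₂ - h₁ * (q + p)) p≡ q≡) e₄ e₄′)
    where
    same : ∀ {x x′ r r′} → r ≡ r′ → + 4 * h₁ * x ≡ r + W h z → + 4 * h₁ * x′ ≡ r′ + W h z′ → x ≡ x′
    same {r = r} refl e e′ = *-cancel (i*j≢0 {+ 4} (λ ()) h₁≢0) (trans (drop-0 {j = r} e W≡0) (sym (drop-0 {j = r} e′ W′≡0)))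

-- The case h₁ = 0

shape : ℤ → ℤ → ℤ → Quad
shape x u v = x , x - u - v , x - u , x - v

shapeCode : Quad → Quad
shapeCode (x₁ , x₂ , y₁ , y₂) = x₁ - y₁ , x₁ - y₂ , x₁ - y₁ , x₁ - y₂

h₁≡0⇒shape : ∀ {h₂ h₄} x₁ x₂ y₁ y₂ → PowerSums (triple 0ℤ h₂ h₄) (x₁ , x₂ , y₁ , y₂) →
  (x₁ , x₂ , y₁ , y₂) ≡ shape x₁ (x₁ - y₁) (x₁ - y₂)
h₁≡0⇒shape x₁ x₂ y₁ y₂ (powerSums sum₁ _ _) =
  Quad-≡ refl (drop-0 (i₂ x₁ x₂ y₁ y₂) sum₁) (i₃ x₁ y₁) (i₃ x₁ y₂)
  where
  i₂ : ∀ x₁ x₂ y₁ y₂ → x₂ ≡ (x₁ - (x₁ - y₁) - (x₁ - y₂)) + (x₁ + x₂ - y₁ - y₂)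
  i₂ = ℤ-Solver.solve-∀
  i₃ : ∀ x y → y ≡ x - (x - y)
  i₃ = ℤ-Solver.solve-∀

shape-sum₂ : ∀ {h x u v} → PowerSums h (shape x u v) → Triple.h₂ h ≡ + 2 * u * v
shape-sum₂ {x = x} {u} {v} (powerSums _ refl _) = identity x u v
  where
  identity : ∀ x u v → x * x + (x - u - v) * (x - u - v) - (x - u) * (x - u) - (x - v) * (x - v) ≡ + 2 * u * v
  identity = ℤ-Solver.solve-∀

shape-sum₄ : ∀ {h x u v} → PowerSums h (shape x u v) → Triple.h₄ h ≡
  + 2 * u * v * (+ 6 * x * (x - u - v) + (+ 2 * u * u + + 3 * u * v + + 2 * v * v))
shape-sum₄ {x = x} {u} {v} (powerSums _ _ refl) = identity x u v
  where
  identity : ∀ x u v → x * x * (x * x) + (x - u - v) * (x - u - v) * ((x - u - v) * (x - u - v))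
      - (x - u) * (x - u) * ((x - u) * (x - u)) - (x - v) * (x - v) * ((x - v) * (x - v))
    ≡ + 2 * u * v * (+ 6 * x * (x - u - v) + (+ 2 * u * u + + 3 * u * v + + 2 * v * v))
  identity = ℤ-Solver.solve-∀

-- For fixed u and v, h₄ is a quadratic in x₁ whose two roots add up to u + v = x₁ - x₂,
-- so the other root is - x₂ < 0.
shape-injective : ∀ {P h} x x′ {u v} → Triple.h₂ h ≢ 0ℤ →
  InBox P (shape x u v) → InBox P (shape x′ u v) →
  PowerSums h (shape x u v) → PowerSums h (shape x′ u v) → x ≡ x′
shape-injective {h = h} x x′ {u} {v} h₂≢0 (_ , r₂ , _) (r₁′ , _) s s′ =
  ℤₚ.i-j≡0⇒i≡j x x′ (*-cancel-0 (+ 6 * (x′ + (x - u - v))) (i*j≢0 {+ 6} (λ ()) (0<⇒≢0 (ℤₚ.+-mono-< (InRange⇒0< r₁′) (InRange⇒0< r₂))))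
    (*-cancel-0 (+ 2 * u * v) 2uv≢0 (trans (identity x x′ u v)
      (ℤₚ.i≡j⇒i-j≡0 (trans (sym (shape-sum₄ {x = x} {u} {v} s)) (shape-sum₄ {x = x′} {u} {v} s′))))))
  where
  2uv≢0 : + 2 * u * v ≢ 0ℤ
  2uv≢0 = λ 2uv≡0 → h₂≢0 (trans (shape-sum₂ {x = x} {u} {v} s) 2uv≡0)
  identity : ∀ x x′ u v → + 2 * u * v * (+ 6 * (x′ + (x - u - v)) * (x - x′))
    ≡ + 2 * u * v * (+ 6 * x * (x - u - v) + (+ 2 * u * u + + 3 * u * v + + 2 * v * v))
    - + 2 * u * v * (+ 6 * x′ * (x′ - u - v) + (+ 2 * u * u + + 3 * u * v + + 2 * v * v))
  identity = ℤ-Solver.solve-∀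

module _ {h₂ h₄ : ℤ} where
  private
    h = triple 0ℤ h₂ h₄

  shapeCode-divides : ∀ z → PowerSums h z → shapeCode z ∣⁴ (+ 3 * h₂)
  shapeCode-divides (x₁ , x₂ , y₁ , y₂) s = u∣ , v∣ , u∣ , v∣
    where
    u = x₁ - y₁
    v = x₁ - y₂
    3*h₂≡ : + 3 * h₂ ≡ + 3 * (+ 2 * u * v)
    3*h₂≡ = cong (+ 3 *_) (shape-sum₂ {h} {x₁} {u} {v} (subst (PowerSums h) (h₁≡0⇒shape x₁ x₂ y₁ y₂ s) s))
    pull-u : ∀ u v → + 3 * (+ 2 * u * v) ≡ u * (+ 6 * v)
    pull-u = ℤ-Solver.solve-∀
    pull-v : ∀ u v → + 3 * (+ 2 * u * v) ≡ v * (+ 6 * u)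
    pull-v = ℤ-Solver.solve-∀
    u∣ = factor⇒∣ u (+ 6 * v) (trans 3*h₂≡ (pull-u u v))
    v∣ = factor⇒∣ v (+ 6 * u) (trans 3*h₂≡ (pull-v u v))

  shapeCode-injective : ∀ {P} z z′ → h₂ ≢ 0ℤ → InBox P z → InBox P z′ → PowerSums h z → PowerSums h z′ →
    shapeCode z ≡ shapeCode z′ → z ≡ z′
  shapeCode-injective {P} z@(x₁ , x₂ , y₁ , y₂) z′@(x₁′ , x₂′ , y₁′ , y₂′) h₂≢0 b b′ s s′ eq
    with Quad-≡⁻ eq | h₁≡0⇒shape x₁ x₂ y₁ y₂ s | h₁≡0⇒shape x₁′ x₂′ y₁′ y₂′ s′
  ... | u≡ , v≡ , _ | z≡ | z′≡ = go (x₁ - y₁) (x₁ - y₂) z≡ (trans z′≡ (cong₂ (shape x₁′) (sym u≡) (sym v≡)))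
    where
    go : ∀ u v → z ≡ shape x₁ u v → z′ ≡ shape x₁′ u v → z ≡ z′
    go u v z≡ z′≡ = trans z≡ (trans (cong (λ x → shape x u v) x₁≡x₁′) (sym z′≡))
      where
      x₁≡x₁′ : x₁ ≡ x₁′
      x₁≡x₁′ = shape-injective {P} {h} x₁ x₁′ {u} {v} h₂≢0 (subst (InBox P) z≡ b) (subst (InBox P) z′≡ b′)
        (subst (PowerSums h) z≡ s) (subst (PowerSums h) z′≡ s′)

-- In the parametrisation by `shape`, h₄ is h₂ = 2 u v times a polynomial.
h₁≡h₂≡0⇒h₄≡0 : ∀ {h₄} z → PowerSums (triple 0ℤ 0ℤ h₄) z → h₄ ≡ 0ℤ
h₁≡h₂≡0⇒h₄≡0 {h₄} z@(x₁ , x₂ , y₁ , y₂) s =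
  trans (shape-sum₄ {x = x₁} {u} {v} s′) (trans (cong (_* r) (sym (shape-sum₂ {x = x₁} {u} {v} s′))) (ℤₚ.*-zeroˡ r))
  where
  u = x₁ - y₁
  v = x₁ - y₂
  r = + 6 * x₁ * (x₁ - u - v) + (+ 2 * u * u + + 3 * u * v + + 2 * v * v)
  s′ : PowerSums (triple 0ℤ 0ℤ h₄) (shape x₁ u v)
  s′ = subst (PowerSums _) (h₁≡0⇒shape x₁ x₂ y₁ y₂ s) s

-- Divisor codes and the case distinction

linear-divisorCode : ∀ P h z → z ∈ solutions P h → Triple.h₁ h ≢ 0ℤ → M h ≢ 0ℤ → DivisorCode P h
linear-divisorCode P h@(triple h₁ h₂ h₄) z₀ z₀∈ h₁≢0 M≢0 = record
  { D         = M h
  ; code      = linearCode {h₂ = h₂} {h₄} h₁≢0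
  ; D≢0       = M≢0
  ; ∣D∣≤      = let b , s = ∈-solutions⁻ P z₀∈ in ∣M∣≤ P h (powerSums-small P h z₀ b s)
  ; divides   = λ {z} z∈ → linearCode-divides h₁≢0 z (proj₂ (∈-solutions⁻ P z∈))
  ; injective = λ {z} {z′} _ _ → linearCode-injective {h₂ = h₂} {h₄} h₁≢0 z z′
  }

shape-divisorCode : ∀ P .{{_ : NonZero P}} {h₂ h₄} z → z ∈ solutions P (triple 0ℤ h₂ h₄) → h₂ ≢ 0ℤ →
  DivisorCode P (triple 0ℤ h₂ h₄)
shape-divisorCode P {h₂} {h₄} z₀ z₀∈ h₂≢0 = record
  { D         = + 3 * h₂
  ; code      = shapeCode
  ; D≢0       = i*j≢0 {+ 3} (λ ()) h₂≢0
  ; ∣D∣≤      = let b , s = ∈-solutions⁻ P z₀∈ in ∣3*h₂∣≤ P h (powerSums-small P h z₀ b s)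
  ; divides   = λ {z} z∈ → shapeCode-divides z (proj₂ (∈-solutions⁻ P z∈))
  ; injective = λ {z} {z′} z∈ z′∈ → let b , s = ∈-solutions⁻ P z∈ ; b′ , s′ = ∈-solutions⁻ P z′∈ in
      shapeCode-injective z z′ h₂≢0 b b′ s s′
  }
  where
  h = triple 0ℤ h₂ h₄

gap-divisorCode : ∀ P .{{_ : NonZero P}} h z → z ∈ solutions P h → Triple.h₁ h ≢ 0ℤ →
  (∀ {z} → z ∈ solutions P h → W h z ≡ 0ℤ) → DivisorCode P h
gap-divisorCode P h z₀ z₀∈ h₁≢0 W≡0 = record
  { D         = + 3 * Triple.h₂ h
  ; code      = gapCode
  ; D≢0       = let b , s = ∈-solutions⁻ P z₀∈ in 3*h₂≢0 {h} h₁≢0 P z₀ b s (W≡0 z₀∈)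
  ; ∣D∣≤      = let b , s = ∈-solutions⁻ P z₀∈ in ∣3*h₂∣≤ P h (powerSums-small P h z₀ b s)
  ; divides   = λ {z} z∈ → gapCode-divides h₁≢0 z (proj₂ (∈-solutions⁻ P z∈)) (W≡0 z∈)
  ; injective = λ {z} {z′} z∈ z′∈ → gapCode-injective h₁≢0 z z′
      (proj₂ (∈-solutions⁻ P z∈)) (proj₂ (∈-solutions⁻ P z′∈)) (W≡0 z∈) (W≡0 z′∈)
  }

-- The case distinctions are on explicit arguments: abstracting them with "with"
-- would normalise integer polynomials of degree 6.
classify : ∀ P .{{_ : NonZero P}} h z → z ∈ solutions P h →
  DivisorCode P h ⊎ ConditionA P h ⊎ ConditionB h
classify P h z z∈ = by-h₁ h z z∈ (Triple.h₁ h ℤ.≟ 0ℤ)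
  where
  by-W : ∀ h z → z ∈ solutions P h → Triple.h₁ h ≢ 0ℤ → M h ≡ 0ℤ →
    Dec (Any.Any (λ z → W h z ≢ 0ℤ) (solutions P h)) → DivisorCode P h ⊎ ConditionA P h ⊎ ConditionB h
  by-W h z z∈ h₁≢0 M≡0 (yes any) = inj₂ (inj₁ (at (find any)))
    where
    at : (∃[ z ] (z ∈ solutions P h × W h z ≢ 0ℤ)) → ConditionA P h
    at (z , z∈ , W≢0) = let b , s = ∈-solutions⁻ P z∈ in W≢0⇒conditionA P h z h₁≢0 M≡0 b s W≢0
  by-W h z z∈ h₁≢0 M≡0 (no ¬any) = inj₁ (gap-divisorCode P h z z∈ h₁≢0
    (λ {z} z∈ → decidable-stable (W h z ℤ.≟ 0ℤ) (λ W≢0 → ¬any (lose z∈ W≢0))))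

  by-M : ∀ h z → z ∈ solutions P h → Triple.h₁ h ≢ 0ℤ → Dec (M h ≡ 0ℤ) →
    DivisorCode P h ⊎ ConditionA P h ⊎ ConditionB h
  by-M h z z∈ h₁≢0 (no M≢0)  = inj₁ (linear-divisorCode P h z z∈ h₁≢0 M≢0)
  by-M h z z∈ h₁≢0 (yes M≡0) = by-W h z z∈ h₁≢0 M≡0 (Any.any? (λ z → ¬? (W h z ℤ.≟ 0ℤ)) (solutions P h))

  by-h₂ : ∀ {h₂ h₄} z → z ∈ solutions P (triple 0ℤ h₂ h₄) → Dec (h₂ ≡ 0ℤ) →
    DivisorCode P (triple 0ℤ h₂ h₄) ⊎ ConditionA P (triple 0ℤ h₂ h₄) ⊎ ConditionB (triple 0ℤ h₂ h₄)
  by-h₂ z z∈ (no h₂≢0)  = inj₁ (shape-divisorCode P z z∈ h₂≢0)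
  by-h₂ z z∈ (yes refl) = inj₂ (inj₂ (refl , refl , sym (h₁≡h₂≡0⇒h₄≡0 z (proj₂ (∈-solutions⁻ P z∈)))))

  by-h₁ : ∀ h z → z ∈ solutions P h → Dec (Triple.h₁ h ≡ 0ℤ) → DivisorCode P h ⊎ ConditionA P h ⊎ ConditionB h
  by-h₁ h z z∈ (no h₁≢0)                   = by-M h z z∈ h₁≢0 (M h ℤ.≟ 0ℤ)
  by-h₁ (triple _ h₂ h₄) z z∈ (yes refl) = by-h₂ z z∈ (h₂ ℤ.≟ 0ℤ)

trichotomy : ∀ K .{{_ : NonZero K}} → ∃[ C ] (∀ P .{{_ : NonZero P}} h →
  T₂ P h ℕ.^ K ℕ.≤ C ℕ.* P ⊎ ConditionA P h ⊎ ConditionB h)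
trichotomy K@(suc _) = proj₁ few , λ P h → cases P h (empty-or-member (solutions P h))
  where
  few = few-solutions K

  empty-or-member : (zs : List Quad) → length zs ≡ 0 ⊎ ∃[ z ] z ∈ zs
  empty-or-member []       = inj₁ refl
  empty-or-member (z ∷ zs) = inj₂ (z , here refl)

  cases : ∀ P .{{_ : NonZero P}} h → T₂ P h ≡ 0 ⊎ ∃[ z ] z ∈ solutions P h →
          T₂ P h ℕ.^ K ℕ.≤ proj₁ few ℕ.* P ⊎ ConditionA P h ⊎ ConditionB h
  -- Without a solution `classify` has nothing to start from, but then T = 0, and 0^K = 0 since K is
  -- a successor.
  cases P h (inj₁ T≡0)      = inj₁ (subst (λ T → T ℕ.^ K ℕ.≤ proj₁ few ℕ.* P) (sym T≡0) z≤n)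
  cases P h (inj₂ (z , z∈)) = map₁ (proj₂ few P h) (classify P h z z∈)

-- The exact counts

map-disjoint : ∀ {A B C : Set} {f : A → C} {g : B → C} {xs ys} →
  (∀ {x y} → x ∈ xs → y ∈ ys → f x ≢ g y) → Disjoint (map f xs) (map g ys)
map-disjoint {f = f} {g} f≢g (v∈f , v∈g) with ∈-map⁻ f v∈f | ∈-map⁻ g v∈g
... | x , x∈ , v≡fx | y , y∈ , v≡gy = f≢g x∈ y∈ (trans (sym v≡fx) v≡gy)

infixl 6 _∖_
_∖_ : List ℤ → ℤ → List ℤ
xs ∖ a = filter (¬? ∘ (ℤ._≟ a)) xs

∈-∖⁺ : ∀ {xs a t} → t ∈ xs → t ≢ a → t ∈ xs ∖ a
∈-∖⁺ {a = a} = ∈-filter⁺ (¬? ∘ (ℤ._≟ a))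

∈-∖⁻ : ∀ {xs a t} → t ∈ xs ∖ a → t ∈ xs × t ≢ a
∈-∖⁻ {xs} {a} = ∈-filter⁻ (¬? ∘ (ℤ._≟ a)) {xs = xs}

∖-unique : ∀ {xs} a → Unique xs → Unique (xs ∖ a)
∖-unique a = Uniqueₚ.filter⁺ (¬? ∘ (ℤ._≟ a))

length-∖ : ∀ {xs a} → Unique xs → a ∈ xs → suc (length (xs ∖ a)) ≡ length xs
length-∖ {xs} {a} xs! a∈xs = trans (cong (ℕ._+ length (xs ∖ a)) (sym only-a)) (length-filter-¬ (ℤ._≟ a) xs)
  where
  only-a : length (filter (ℤ._≟ a) xs) ≡ 1
  only-a = length-≡ {ys = a ∷ []} (Uniqueₚ.filter⁺ (ℤ._≟ a) xs!) ([] ∷ [])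
    (λ t∈ → here (proj₂ (∈-filter⁻ (ℤ._≟ a) {xs = xs} t∈)))
    (λ { (here refl) → ∈-filter⁺ (ℤ._≟ a) a∈xs refl })

-- The count under condition (a)

module _ (P : ℕ) {h : Triple} {a b : ℤ} (a≢b : a ≢ b) (aᵣ : InRange P a) (bᵣ : InRange P b)
         (matches : Matches (λ j → a ℤ.^ j - b ℤ.^ j) h) where

  private
    h₁ = Triple.h₁ h
    h₂ = Triple.h₂ h
    h₄ = Triple.h₄ h

    a-b≢0 : a - b ≢ 0ℤ
    a-b≢0 = a≢b ∘ ℤₚ.i-j≡0⇒i≡j a b

    h≡ : h ≡ triple (a - b) (a * a - b * b) (a * a * (a * a) - b * b * (b * b))
    h≡ = triple-≡ (trans (sym (proj₁ matches)) (cong₂ _-_ (ℤₚ.^-identityʳ a) (ℤₚ.^-identityʳ b)))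
      (trans (sym (proj₁ (proj₂ matches))) (cong₂ _-_ (i^2≡i*i a) (i^2≡i*i b)))
      (trans (sym (proj₂ (proj₂ matches))) (cong₂ _-_ (i^4≡i*i*[i*i] a) (i^4≡i*i*[i*i] b)))
      where
      triple-≡ : ∀ {i j k i′ j′ k′} → i ≡ i′ → j ≡ j′ → k ≡ k′ → triple i j k ≡ triple i′ j′ k′
      triple-≡ refl refl refl = refl

  M≡0 : M h ≡ 0ℤ
  M≡0 = trans (cong M h≡) (identity a b)
    where
    identity : ∀ a b → let h₁ = a - b ; h₂ = a * a - b * b ; h₄ = a * a * (a * a) - b * b * (b * b) in
      h₂ * h₂ * h₂ + h₁ * h₁ * h₁ * h₁ * h₂ - + 2 * h₁ * h₁ * h₄ ≡ + 0
    identity = ℤ-Solver.solve-∀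

  -- For these coefficients W is a - b times a sum of six positive integers.
  W≢0 : ∀ z → InBox P z → W h z ≢ 0ℤ
  W≢0 (x₁ , x₂ , y₁ , y₂) (r₁ , r₂ , r₃ , r₄) W≡0 = i*j≢0 a-b≢0
    (0<⇒≢0 (ℤₚ.+-mono-< (ℤₚ.+-mono-< (ℤₚ.+-mono-< (ℤₚ.+-mono-< (ℤₚ.+-mono-<
      (InRange⇒0< aᵣ) (InRange⇒0< bᵣ)) (InRange⇒0< r₁)) (InRange⇒0< r₂)) (InRange⇒0< r₃)) (InRange⇒0< r₄)))
    (trans (identity a b x₁ x₂ y₁ y₂) (trans (cong (λ h → W h (x₁ , x₂ , y₁ , y₂)) (sym h≡)) W≡0))
    where
    identity : ∀ a b x₁ x₂ y₁ y₂ → (a - b) * (a + b + x₁ + x₂ + y₁ + y₂)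
      ≡ a * a - b * b + (a - b) * (x₁ + x₂ + y₁ + y₂)
    identity = ℤ-Solver.solve-∀

  private
    2[a-b]≢0 : + 2 * (a - b) ≢ 0ℤ
    2[a-b]≢0 = i*j≢0 {+ 2} (λ ()) a-b≢0

  X≡0⇒≡a : ∀ x → X h x ≡ 0ℤ → x ≡ a
  X≡0⇒≡a x X≡0 = ℤₚ.i-j≡0⇒i≡j x a (*-cancel-0 (+ 2 * (a - b)) 2[a-b]≢0
    (trans (identity a b x) (trans (cong (λ h → X h x) (sym h≡)) X≡0)))
    where
    identity : ∀ a b x → + 2 * (a - b) * (x - a) ≡ + 2 * (a - b) * x - ((a - b) * (a - b) + (a * a - b * b))
    identity = ℤ-Solver.solve-∀

  Y≡0⇒≡b : ∀ y → Y h y ≡ 0ℤ → y ≡ b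
  Y≡0⇒≡b y Y≡0 = ℤₚ.i-j≡0⇒i≡j y b (*-cancel-0 (+ 2 * (a - b)) 2[a-b]≢0
    (trans (identity a b y) (trans (cong (λ h → Y h y) (sym h≡)) Y≡0)))
    where
    identity : ∀ a b y → + 2 * (a - b) * (y - b) ≡ + 2 * (a - b) * y - ((a * a - b * b) - (a - b) * (a - b))
    identity = ℤ-Solver.solve-∀

  data FormA : Quad → Set where
    form₁ : ∀ t → FormA (a , t , b , t)
    form₂ : ∀ t → FormA (t , a , b , t)
    form₃ : ∀ t → FormA (a , t , t , b)
    form₄ : ∀ t → FormA (t , a , t , b)

  -- Since M = 0 and W ≠ 0, some xᵢ is a root of `X`, hence a, and some yⱼ is a root of `Y`, hence
  -- b. The linear equation makes the other two coordinates equal.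
  solution-formA : ∀ z → InBox P z → PowerSums h z → FormA z
  solution-formA z@(x₁ , x₂ , y₁ , y₂) inBox s = choose
      (map⊎ (X≡0⇒≡a x₁) (X≡0⇒≡a x₂) (split (X h) (trans (sym (M-factor-x s)) M≡0)))
      (map⊎ (Y≡0⇒≡b y₁) (Y≡0⇒≡b y₂) (split (Y h) (trans (sym (M-factor-y s)) M≡0)))
      (trans (PowerSums.sum₁ s) (cong Triple.h₁ h≡))
    where
    split : ∀ (f : ℤ → ℤ) {i j} → W h z * (f i * f j) ≡ 0ℤ → f i ≡ 0ℤ ⊎ f j ≡ 0ℤ
    split f {i} eq = ℤₚ.i*j≡0⇒i≡0∨j≡0 (f i) (*-cancel-0 (W h z) (W≢0 z inBox) eq)
    rest : ∀ {x x′ y y′} → x ≡ a → y ≡ b → x + x′ - y - y′ ≡ a - b → x′ ≡ y′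
    rest {_} {x′} {_} {y′} refl refl sum =
      ℤₚ.i-j≡0⇒i≡j x′ y′ (trans (identity a b x′ y′) (ℤₚ.i≡j⇒i-j≡0 sum))
      where
      identity : ∀ a b t u → t - u ≡ (a + t - b - u) - (a - b)
      identity = ℤ-Solver.solve-∀
    x-swap : ∀ x x′ y y′ → x′ + x - y - y′ ≡ x + x′ - y - y′
    x-swap = ℤ-Solver.solve-∀
    y-swap : ∀ x x′ y y′ → x + x′ - y′ - y ≡ x + x′ - y - y′
    y-swap = ℤ-Solver.solve-∀
    xy-swap : ∀ x x′ y y′ → x′ + x - y′ - y ≡ x + x′ - y - y′
    xy-swap = ℤ-Solver.solve-∀
    to-form₁ : ∀ {x₁ x₂ y₁ y₂} → x₁ ≡ a → y₁ ≡ b → x₂ ≡ y₂ → FormA (x₁ , x₂ , y₁ , y₂)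
    to-form₁ refl refl refl = form₁ _
    to-form₂ : ∀ {x₁ x₂ y₁ y₂} → x₂ ≡ a → y₁ ≡ b → x₁ ≡ y₂ → FormA (x₁ , x₂ , y₁ , y₂)
    to-form₂ refl refl refl = form₂ _
    to-form₃ : ∀ {x₁ x₂ y₁ y₂} → x₁ ≡ a → y₂ ≡ b → x₂ ≡ y₁ → FormA (x₁ , x₂ , y₁ , y₂)
    to-form₃ refl refl refl = form₃ _
    to-form₄ : ∀ {x₁ x₂ y₁ y₂} → x₂ ≡ a → y₂ ≡ b → x₁ ≡ y₁ → FormA (x₁ , x₂ , y₁ , y₂)
    to-form₄ refl refl refl = form₄ _
    choose : x₁ ≡ a ⊎ x₂ ≡ a → y₁ ≡ b ⊎ y₂ ≡ b → x₁ + x₂ - y₁ - y₂ ≡ a - b → FormA z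
    choose (inj₁ x₁≡) (inj₁ y₁≡) sum = to-form₁ x₁≡ y₁≡ (rest x₁≡ y₁≡ sum)
    choose (inj₂ x₂≡) (inj₁ y₁≡) sum = to-form₂ x₂≡ y₁≡ (rest x₂≡ y₁≡ (trans (x-swap x₁ x₂ y₁ y₂) sum))
    choose (inj₁ x₁≡) (inj₂ y₂≡) sum = to-form₃ x₁≡ y₂≡ (rest x₁≡ y₂≡ (trans (y-swap x₁ x₂ y₁ y₂) sum))
    choose (inj₂ x₂≡) (inj₂ y₂≡) sum = to-form₄ x₂≡ y₂≡ (rest x₂≡ y₂≡ (trans (xy-swap x₁ x₂ y₁ y₂) sum))

  formA-isSolution : ∀ {z} → FormA z → IsSolution h z
  formA-isSolution {z} form =
    trans (power form 1) (proj₁ matches) , trans (power form 2) (proj₁ (proj₂ matches)) , trans (power form 4) (proj₂ (proj₂ matches))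
    where
    i₁ : ∀ a b t → a + t - b - t ≡ a - b
    i₁ = ℤ-Solver.solve-∀
    i₂ : ∀ a b t → t + a - b - t ≡ a - b
    i₂ = ℤ-Solver.solve-∀
    i₃ : ∀ a b t → a + t - t - b ≡ a - b
    i₃ = ℤ-Solver.solve-∀
    i₄ : ∀ a b t → t + a - t - b ≡ a - b
    i₄ = ℤ-Solver.solve-∀
    power : ∀ {z} → FormA z → ∀ j → powerSum z j ≡ a ℤ.^ j - b ℤ.^ j
    power (form₁ t) j = i₁ (a ℤ.^ j) (b ℤ.^ j) (t ℤ.^ j)
    power (form₂ t) j = i₂ (a ℤ.^ j) (b ℤ.^ j) (t ℤ.^ j)
    power (form₃ t) j = i₃ (a ℤ.^ j) (b ℤ.^ j) (t ℤ.^ j)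
    power (form₄ t) j = i₄ (a ℤ.^ j) (b ℤ.^ j) (t ℤ.^ j)

  private
    R = range P
    R! = range-unique P
    f₁ f₂ f₃ f₄ : ℤ → Quad
    f₁ t = a , t , b , t
    f₂ t = t , a , b , t
    f₃ t = a , t , t , b
    f₄ t = t , a , t , b

    -- Coincidences are kept once: `f₂` meets `f₁` at t = a, `f₃` meets `f₁` at t = b, and `f₄`
    -- meets `f₃` at t = a and `f₂` at t = b. The lengths P, P - 1, P - 1, P - 2 add up to 4 P - 4.
    pieces : List (List Quad)
    pieces = map f₁ R ∷ map f₂ (R ∖ a) ∷ map f₃ (R ∖ b) ∷ map f₄ (R ∖ a ∖ b) ∷ []

    pieces-unique : Unique (concat pieces)
    pieces-unique = Uniqueₚ.concat⁺
      ( Uniqueₚ.map⁺ (λ { refl → refl }) R!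
      ∷ Uniqueₚ.map⁺ (λ { refl → refl }) (∖-unique a R!)
      ∷ Uniqueₚ.map⁺ (λ { refl → refl }) (∖-unique b R!)
      ∷ Uniqueₚ.map⁺ (λ { refl → refl }) (∖-unique b (∖-unique a R!))
      ∷ [])
      ( ( map-disjoint {f = f₁} {f₂} (λ _ t∈ eq → proj₂ (∈-∖⁻ {R} t∈) (sym (cong proj₁ eq)))
        ∷ map-disjoint {f = f₁} {f₃} (λ _ t∈ eq → proj₂ (∈-∖⁻ {R} t∈) (sym (cong (proj₁ ∘ proj₂ ∘ proj₂) eq)))
        ∷ map-disjoint {f = f₁} {f₄} (λ _ t∈ eq → proj₂ (∈-∖⁻ {R} (proj₁ (∈-∖⁻ {R ∖ a} t∈))) (sym (cong proj₁ eq)))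
        ∷ [])
      ∷ ( map-disjoint {f = f₂} {f₃} (λ t∈ _ eq → proj₂ (∈-∖⁻ {R} t∈) (cong proj₁ eq))
        ∷ map-disjoint {f = f₂} {f₄} (λ _ t∈ eq → proj₂ (∈-∖⁻ {R ∖ a} t∈) (sym (cong (proj₁ ∘ proj₂ ∘ proj₂) eq)))
        ∷ [])
      ∷ ( map-disjoint {f = f₃} {f₄} (λ _ t∈ eq → proj₂ (∈-∖⁻ {R} (proj₁ (∈-∖⁻ {R ∖ a} t∈))) (sym (cong proj₁ eq)))
        ∷ [])
      ∷ [] ∷ [])

    pieces⊆solutions : concat pieces ⊆ solutions P h
    pieces⊆solutions {z} z∈ with ∈-concat⁻′ pieces z∈
    ... | _ , z∈zs , here refl with ∈-map⁻ f₁ z∈zs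
    ... | t , t∈ , refl = ∈-solutions⁺ P (aᵣ , ∈-range⁻ t∈ , bᵣ , ∈-range⁻ t∈) (formA-isSolution (form₁ t))
    pieces⊆solutions {z} z∈ | _ , z∈zs , there (here refl) with ∈-map⁻ f₂ z∈zs
    ... | t , t∈ , refl = ∈-solutions⁺ P (tᵣ , aᵣ , bᵣ , tᵣ) (formA-isSolution (form₂ t))
      where tᵣ = ∈-range⁻ (proj₁ (∈-∖⁻ {R} t∈))
    pieces⊆solutions {z} z∈ | _ , z∈zs , there (there (here refl)) with ∈-map⁻ f₃ z∈zs
    ... | t , t∈ , refl = ∈-solutions⁺ P (aᵣ , tᵣ , tᵣ , bᵣ) (formA-isSolution (form₃ t))
      where tᵣ = ∈-range⁻ (proj₁ (∈-∖⁻ {R} t∈))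
    pieces⊆solutions {z} z∈ | _ , z∈zs , there (there (there (here refl))) with ∈-map⁻ f₄ z∈zs
    ... | t , t∈ , refl = ∈-solutions⁺ P (tᵣ , aᵣ , tᵣ , bᵣ) (formA-isSolution (form₄ t))
      where tᵣ = ∈-range⁻ (proj₁ (∈-∖⁻ {R} (proj₁ (∈-∖⁻ {R ∖ a} t∈))))

    in₁ : ∀ {t} → t ∈ R → f₁ t ∈ concat pieces
    in₁ t∈ = ∈-concat⁺′ {xss = pieces} (∈-map⁺ f₁ t∈) (here refl)
    in₂ : ∀ {t} → t ∈ R → t ≢ a → f₂ t ∈ concat pieces
    in₂ t∈ t≢a = ∈-concat⁺′ {xss = pieces} (∈-map⁺ f₂ (∈-∖⁺ t∈ t≢a)) (there (here refl))
    in₃ : ∀ {t} → t ∈ R → t ≢ b → f₃ t ∈ concat pieces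
    in₃ t∈ t≢b = ∈-concat⁺′ {xss = pieces} (∈-map⁺ f₃ (∈-∖⁺ t∈ t≢b)) (there (there (here refl)))
    in₄ : ∀ {t} → t ∈ R → t ≢ a → t ≢ b → f₄ t ∈ concat pieces
    in₄ t∈ t≢a t≢b = ∈-concat⁺′ {xss = pieces} (∈-map⁺ f₄ (∈-∖⁺ (∈-∖⁺ t∈ t≢a) t≢b)) (there (there (there (here refl))))

    formA∈pieces : ∀ {z} → FormA z → InBox P z → z ∈ concat pieces
    formA∈pieces (form₁ t) (_ , tᵣ , _) = in₁ (∈-range⁺ tᵣ)
    formA∈pieces (form₂ t) (tᵣ , _) with t ℤ.≟ a
    ... | yes refl = in₁ (∈-range⁺ tᵣ)
    ... | no t≢a   = in₂ (∈-range⁺ tᵣ) t≢a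
    formA∈pieces (form₃ t) (_ , tᵣ , _) with t ℤ.≟ b
    ... | yes refl = in₁ (∈-range⁺ tᵣ)
    ... | no t≢b   = in₃ (∈-range⁺ tᵣ) t≢b
    formA∈pieces (form₄ t) (tᵣ , _) with t ℤ.≟ a | t ℤ.≟ b
    ... | yes refl | _        = in₃ (∈-range⁺ tᵣ) a≢b
    ... | no t≢a   | yes refl = in₂ (∈-range⁺ tᵣ) t≢a
    ... | no t≢a   | no t≢b   = in₄ (∈-range⁺ tᵣ) t≢a t≢b

    solutions⊆pieces : solutions P h ⊆ concat pieces
    solutions⊆pieces {z} z∈ = let inBox , s = ∈-solutions⁻ P z∈ in
      formA∈pieces (solution-formA z inBox s) inBox

    length-pieces : length (concat pieces) ≡ countA P
    length-pieces = begin
      length (concat pieces)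
        ≡⟨ length-map-++ f₁ R (length-map-++ f₂ (R ∖ a) (length-map-++ f₃ (R ∖ b) (length-map-++ f₄ (R ∖ a ∖ b) {zs = []} refl))) ⟩
      length R ℕ.+ (length (R ∖ a) ℕ.+ (length (R ∖ b) ℕ.+ (length (R ∖ a ∖ b) ℕ.+ 0)))
        ≡⟨ count P _ _ _ _ (length-range P) (length-∖ R! (∈-range⁺ aᵣ)) (length-∖ R! (∈-range⁺ bᵣ))
             (length-∖ (∖-unique a R!) (∈-∖⁺ (∈-range⁺ bᵣ) (a≢b ∘ sym))) ⟩
      countA P ∎
      where
      open ≡-Reasoning
      length-map-++ : ∀ (f : ℤ → Quad) ts {zs n} → length zs ≡ n → length (map f ts ++ zs) ≡ length ts ℕ.+ n
      length-map-++ f ts refl = trans (length-++ (map f ts)) (cong (ℕ._+ _) (length-map f ts))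
      count : ∀ P k l m n → k ≡ P → suc l ≡ k → suc m ≡ k → suc n ≡ l →
        k ℕ.+ (l ℕ.+ (m ℕ.+ (n ℕ.+ 0))) ≡ countA P
      count P k l m n refl refl refl refl =
        trans (sym (ℕₚ.m+n∸m≡n 4 _)) (cong (ℕ._∸ 4) (identity n))
        where
        identity : ∀ n → 4 ℕ.+ (suc (suc n) ℕ.+ (suc n ℕ.+ (suc n ℕ.+ (n ℕ.+ 0)))) ≡ 4 ℕ.* suc (suc n)
        identity = ℕ-Solver.solve-∀

  T₂≡countA : T₂ P h ≡ countA P
  T₂≡countA = trans (length-≡ (solutions-unique P h) pieces-unique solutions⊆pieces pieces⊆solutions) length-pieces

-- The count under condition (b)

data FormB : Quad → Set where
  straight : ∀ x y → FormB (x , y , x , y)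
  crossed  : ∀ x y → FormB (x , y , y , x)

-- Here 2 (x₁ - y₁) (x₁ - y₂) = h₂ = 0, so x₁ equals some yⱼ, and the linear equation matches the
-- remaining pair.
solution-formB : ∀ z → PowerSums (triple 0ℤ 0ℤ 0ℤ) z → FormB z
solution-formB z@(x₁ , x₂ , y₁ , y₂) s = choose (ℤₚ.i*j≡0⇒i≡0∨j≡0 u uv≡0)
  where
  u = x₁ - y₁
  v = x₁ - y₂
  z≡shape : z ≡ shape x₁ u v
  z≡shape = h₁≡0⇒shape x₁ x₂ y₁ y₂ s
  uv≡0 : u * v ≡ 0ℤ
  uv≡0 = *-cancel-0 (+ 2) (λ ()) (trans (sym (ℤₚ.*-assoc (+ 2) u v))
    (sym (shape-sum₂ {x = x₁} {u} {v} (subst (PowerSums _) z≡shape s))))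
  x₂≡ : x₂ ≡ x₁ - u - v
  x₂≡ = cong (proj₁ ∘ proj₂) z≡shape
  to-y₂ : ∀ x₁ y₁ y₂ → x₁ - (x₁ - y₁) - (x₁ - y₂) ≡ y₂ - (x₁ - y₁)
  to-y₂ = ℤ-Solver.solve-∀
  to-y₁ : ∀ x₁ y₁ y₂ → x₁ - (x₁ - y₁) - (x₁ - y₂) ≡ y₁ - (x₁ - y₂)
  to-y₁ = ℤ-Solver.solve-∀
  minus-0 : ∀ {i j k} → i ≡ j - k → k ≡ 0ℤ → i ≡ j
  minus-0 {j = j} i≡ refl = trans i≡ (ℤₚ.+-identityʳ j)
  straight′ : x₁ ≡ y₁ → x₂ ≡ y₂ → FormB z
  straight′ refl refl = straight x₁ x₂
  crossed′ : x₁ ≡ y₂ → x₂ ≡ y₁ → FormB z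
  crossed′ refl refl = crossed x₁ x₂
  choose : u ≡ 0ℤ ⊎ v ≡ 0ℤ → FormB z
  choose (inj₁ u≡0) = straight′ (ℤₚ.i-j≡0⇒i≡j x₁ y₁ u≡0) (minus-0 {k = u} (trans x₂≡ (to-y₂ x₁ y₁ y₂)) u≡0)
  choose (inj₂ v≡0) = crossed′ (ℤₚ.i-j≡0⇒i≡j x₁ y₂ v≡0) (minus-0 {k = v} (trans x₂≡ (to-y₁ x₁ y₁ y₂)) v≡0)

formB-isSolution : ∀ {z} → FormB z → IsSolution (triple 0ℤ 0ℤ 0ℤ) z
formB-isSolution form = power form 1 , power form 2 , power form 4
  where
  i₁ : ∀ a b → a + b - a - b ≡ + 0
  i₁ = ℤ-Solver.solve-∀
  i₂ : ∀ a b → a + b - b - a ≡ + 0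
  i₂ = ℤ-Solver.solve-∀
  power : ∀ {z} → FormB z → ∀ j → powerSum z j ≡ 0ℤ
  power (straight x y) j = i₁ (x ℤ.^ j) (y ℤ.^ j)
  power (crossed x y)  j = i₂ (x ℤ.^ j) (y ℤ.^ j)

module _ (P : ℕ) where

  private
    R = range P
    R! = range-unique P
    R² = cartesianProduct R R
    R²! = Uniqueₚ.cartesianProduct⁺ R! R!

    equal? : ∀ (xy : ℤ × ℤ) → Dec (proj₁ xy ≡ proj₂ xy)
    equal? (x , y) = x ℤ.≟ y

    diagonal = filter equal? R²
    off-diagonal = filter (¬? ∘ equal?) R²

    f g : ℤ × ℤ → Quad
    f (x , y) = x , y , x , y
    g (x , y) = x , y , y , x

    -- Straight and crossed solutions coincide exactly when x = y, so the crossed ones are taken off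
    -- the diagonal: P² + (P² - P).
    pieces : List Quad
    pieces = map f R² ++ map g off-diagonal

    length-diagonal : length diagonal ≡ P
    length-diagonal = begin
      length diagonal               ≡⟨ length-≡ (Uniqueₚ.filter⁺ equal? R²!) (Uniqueₚ.map⁺ (cong proj₁) R!) to from ⟩
      length (map (λ x → x , x) R)  ≡⟨ length-map _ R ⟩
      length R                      ≡⟨ length-range P ⟩
      P                             ∎
      where
      open ≡-Reasoning
      to : diagonal ⊆ map (λ x → x , x) R
      to {x , y} xy∈ with ∈-filter⁻ equal? {xs = R²} xy∈
      ... | xy∈R² , refl = ∈-map⁺ (λ x → x , x) (proj₁ (∈-cartesianProduct⁻ R R xy∈R²))
      from : map (λ x → x , x) R ⊆ diagonal
      from v∈ with ∈-map⁻ (λ x → x , x) v∈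
      ... | x , x∈ , refl = ∈-filter⁺ equal? (∈-cartesianProduct⁺ x∈ x∈) refl

    pieces-unique : Unique pieces
    pieces-unique = Uniqueₚ.++⁺
      (Uniqueₚ.map⁺ (λ { refl → refl }) R²!)
      (Uniqueₚ.map⁺ (λ { refl → refl }) (Uniqueₚ.filter⁺ (¬? ∘ equal?) R²!))
      (map-disjoint {f = f} {g} (λ _ xy∈ eq → proj₂ (∈-filter⁻ (¬? ∘ equal?) {xs = R²} xy∈)
        (trans (sym (cong proj₁ eq)) (cong (proj₁ ∘ proj₂ ∘ proj₂) eq))))

    pieces⊆solutions : pieces ⊆ solutions P (triple 0ℤ 0ℤ 0ℤ)
    pieces⊆solutions z∈ with ∈-++⁻ (map f R²) z∈
    ... | inj₁ z∈f with ∈-map⁻ f z∈f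
    ... | (x , y) , xy∈ , refl = let x∈ , y∈ = ∈-cartesianProduct⁻ R R xy∈ in
      ∈-solutions⁺ P (∈-range⁻ x∈ , ∈-range⁻ y∈ , ∈-range⁻ x∈ , ∈-range⁻ y∈) (formB-isSolution (straight x y))
    pieces⊆solutions z∈ | inj₂ z∈g with ∈-map⁻ g z∈g
    ... | (x , y) , xy∈ , refl = let x∈ , y∈ = ∈-cartesianProduct⁻ R R (proj₁ (∈-filter⁻ (¬? ∘ equal?) {xs = R²} xy∈)) in
      ∈-solutions⁺ P (∈-range⁻ x∈ , ∈-range⁻ y∈ , ∈-range⁻ y∈ , ∈-range⁻ x∈) (formB-isSolution (crossed x y))

    formB∈pieces : ∀ {z} → FormB z → InBox P z → z ∈ pieces
    formB∈pieces (straight x y) (xᵣ , yᵣ , _) =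
      ∈-++⁺ˡ (∈-map⁺ f (∈-cartesianProduct⁺ (∈-range⁺ xᵣ) (∈-range⁺ yᵣ)))
    formB∈pieces (crossed x y) (xᵣ , yᵣ , _) with x ℤ.≟ y
    ... | yes refl = ∈-++⁺ˡ (∈-map⁺ f (∈-cartesianProduct⁺ (∈-range⁺ xᵣ) (∈-range⁺ xᵣ)))
    ... | no x≢y   = ∈-++⁺ʳ (map f R²) (∈-map⁺ g
      (∈-filter⁺ (¬? ∘ equal?) (∈-cartesianProduct⁺ (∈-range⁺ xᵣ) (∈-range⁺ yᵣ)) x≢y))

    solutions⊆pieces : solutions P (triple 0ℤ 0ℤ 0ℤ) ⊆ pieces
    solutions⊆pieces {z} z∈ = let inBox , s = ∈-solutions⁻ P z∈ in formB∈pieces (solution-formB z s) inBox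

    length-pieces : length pieces ≡ countB P
    length-pieces = begin
      length pieces                                   ≡⟨ length-++ (map f R²) ⟩
      length (map f R²) ℕ.+ length (map g off-diagonal) ≡⟨ cong₂ ℕ._+_ (length-map f R²) (length-map g off-diagonal) ⟩
      length R² ℕ.+ length off-diagonal               ≡⟨ sym (ℕₚ.m+n∸m≡n P _) ⟩
      P ℕ.+ (length R² ℕ.+ length off-diagonal) ℕ.∸ P ≡⟨ cong (ℕ._∸ P) (regroup P (length R²) (length off-diagonal)) ⟩
      length R² ℕ.+ (P ℕ.+ length off-diagonal) ℕ.∸ P ≡⟨ cong (λ n → length R² ℕ.+ n ℕ.∸ P) P+off ⟩
      length R² ℕ.+ length R² ℕ.∸ P                   ≡⟨ cong (λ n → n ℕ.+ n ℕ.∸ P) length-R² ⟩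
      P ℕ.* P ℕ.+ P ℕ.* P ℕ.∸ P                       ≡⟨ cong (ℕ._∸ P) (double P) ⟩
      countB P                                        ∎
      where
      open ≡-Reasoning
      regroup : ∀ k l m → k ℕ.+ (l ℕ.+ m) ≡ l ℕ.+ (k ℕ.+ m)
      regroup = ℕ-Solver.solve-∀
      double : ∀ n → n ℕ.* n ℕ.+ n ℕ.* n ≡ 2 ℕ.* (n ℕ.* (n ℕ.* 1))
      double = ℕ-Solver.solve-∀
      P+off : P ℕ.+ length off-diagonal ≡ length R²
      P+off = trans (cong (ℕ._+ length off-diagonal) (sym length-diagonal)) (length-filter-¬ equal? R²)
      length-R² : length R² ≡ P ℕ.* P
      length-R² = trans (length-cartesianProduct R R) (cong₂ ℕ._*_ (length-range P) (length-range P))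

  T₂≡countB : T₂ P (triple 0ℤ 0ℤ 0ℤ) ≡ countB P
  T₂≡countB = trans (length-≡ (solutions-unique P (triple 0ℤ 0ℤ 0ℤ)) pieces-unique solutions⊆pieces pieces⊆solutions) length-pieces

-- Conclusion

conditionA-count : ∀ P h → ConditionA P h → ConditionA P h × T₂ P h ≡ countA P
conditionA-count P h A@(a , b , a≢b , 1≤a , a≤P , 1≤b , b≤P , matches) =
  A , T₂≡countA P a≢b (1≤a , a≤P) (1≤b , b≤P) matches

conditionB-count : ∀ P h → ConditionB h → ConditionB h × T₂ P h ≡ countB P
conditionB-count P (triple _ _ _) B@(refl , refl , refl) = B , T₂≡countB P

theorem1p3 : ( (η : ℝ) → 0< η → η <1 →
    ∃[ P₀ ] ((P : ℕ) → P₀ ≤ P → 1 ≤ P → (h : Triple) →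
    PowerBelow P η (T₂ P h) →
    (ConditionA P h × T₂ P h ≡ countA P)
    ⊎ (ConditionB h × T₂ P h ≡ countB P)) )
    ×
    ( (ε : ℝ) → 0< ε →
    ∃[ C ] ((P : ℕ) → 1 ≤ P → (h : Triple) →
    ¬ ConditionA P h → ¬ ConditionB h →
    BoundedByPower (T₂ P h) C P ε) )
theorem1p3 = many , few
  where
  many : (η : ℝ) → 0< η → η <1 →
    ∃[ P₀ ] ((P : ℕ) → P₀ ≤ P → 1 ≤ P → (h : Triple) → PowerBelow P η (T₂ P h) →
      (ConditionA P h × T₂ P h ≡ countA P) ⊎ (ConditionB h × T₂ P h ≡ countB P))
  many η 0<η _ with archimedean η 0<η
  ... | K , K≢0 , below with trichotomy (K ℕ.* 2) {{ℕₚ.m*n≢0 K 2 {{K≢0}}}}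
  -- `power-gap` would force P ≤ C, which P ≥ C + 1 excludes.
  ... | C , split = suc C , large
    where
    large : (P : ℕ) → suc C ≤ P → 1 ≤ P → (h : Triple) → PowerBelow P η (T₂ P h) →
      (ConditionA P h × T₂ P h ≡ countA P) ⊎ (ConditionB h × T₂ P h ≡ countB P)
    large P C<P 1≤P h (p , q , q≢0 , Uη , P^p<T^q) with split P {{ℕ.>-nonZero 1≤P}} h
    ... | inj₁ T^2K≤C*P = contradiction
      (power-gap {P} {p} {q} {K} {{ℕ.>-nonZero 1≤P}} {{K≢0}} (below p q {{q≢0}} Uη) P^p<T^q T^2K≤C*P) (ℕₚ.<⇒≱ C<P)
    ... | inj₂ (inj₁ A) = inj₁ (conditionA-count P h A)
    ... | inj₂ (inj₂ B) = inj₂ (conditionB-count P h B)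

  few : (ε : ℝ) → 0< ε → ∃[ C ] ((P : ℕ) → 1 ≤ P → (h : Triple) →
    ¬ ConditionA P h → ¬ ConditionB h → BoundedByPower (T₂ P h) C P ε)
  few ε 0<ε with archimedean ε 0<ε
  ... | K , K≢0 , below with trichotomy K {{K≢0}}
  ... | C , split = C , bounded
    where
    bounded : (P : ℕ) → 1 ≤ P → (h : Triple) → ¬ ConditionA P h → ¬ ConditionB h → BoundedByPower (T₂ P h) C P ε
    bounded P 1≤P h ¬A ¬B p q Uε with split P {{ℕ.>-nonZero 1≤P}} h
    ... | inj₁ T^K≤C*P  = root-≤ {P} {p} {q} {K} {{ℕ.>-nonZero 1≤P}} {{K≢0}} (below p q Uε) T^K≤C*P
    ... | inj₂ (inj₁ A) = contradiction A ¬A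
    ... | inj₂ (inj₂ B) = contradiction B ¬B
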